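{- There exists an oracle $D$ such that $\#\mathrm{P}_1^D\subseteq\mathrm{FP}^D\neq\#\mathrm{P}^D$.
   Context: For an oracle $D$: $\#\mathrm{P}^D$ is the class of functions $x\mapsto$ (number of accepting paths of $M^D$ on $x$) for nondeterministic polynomial-time oracle machines $M$; $\#\mathrm{P}_1^D$ is the same with $M$ restricted to a unary input alphabet; $\mathrm{FP}^D$ is the class of functions computable by deterministic polynomial-time oracle transducers with oracle $D$. -}

module Defs where

open import Data.Nat using (ℕ; zero; suc; _+_; _^_; _≤_)
open import Data.Bool using (Bool; true; false)
open import Data.Fin using (Fin)
open import Data.List using (List; []; _∷_; length; map; reverse; _++_; replicate)
open import Data.Maybe using (Maybe; just; nothing)
import Data.Maybe as Maybe
open import Data.Product using (Σ; _×_; _,_)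
open import Data.Unit using (⊤)
open import Data.Empty using (⊥)
open import Relation.Binary.PropositionalEquality using (_≡_)
open import Relation.Nullary using (¬_)

Oracle : Set
Oracle = List Bool → Bool

data Sym : Set where
  blank : Sym
  bit   : Bool → Sym

data Move : Set where
  L R S : Move

-- Two-way infinite tape as a zipper (cells beyond the lists are blank).
record Tape : Set where
  constructor tape
  field
    left  : List Sym   -- cells to the left of the head, nearest first
    here  : Sym
    right : List Sym   -- cells to the right of the head, nearest first
open Tape public

blankTape : Tape
blankTape = tape [] blank []

writeMove : Sym → Move → Tape → Tape
writeMove s L (tape []       _ r) = tape [] blank (s ∷ r)
writeMove s L (tape (x ∷ l)  _ r) = tape l x (s ∷ r)
writeMove s R (tape l _ [])       = tape (s ∷ l) blank []
writeMove s R (tape l _ (x ∷ r))  = tape (s ∷ l) x r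
writeMove s S (tape l _ r)        = tape l s r

symsBits : List Sym → List Bool
symsBits []            = []
symsBits (blank ∷ ss)  = symsBits ss
symsBits (bit b ∷ ss)  = b ∷ symsBits ss

tapeBits : Tape → List Bool
tapeBits (tape l h r) = symsBits (reverse l ++ (h ∷ r))

data Kind : Set where
  normal query accept reject : Kind

-- A nondeterministic oracle Turing machine with a work tape (which initially
-- holds the input) and an oracle query tape.  In a normal state the machine
-- reads both tapes and chooses among the listed transitions (new state,
-- symbol written / move on the work tape, symbol written / move on the oracle
-- tape).  In a query state it asks the oracle about the string on the oracle
-- tape, the oracle tape is erased, and it moves to  answer q (D query) .
record OTM : Set where
  field
    Q      : ℕ
    start  : Fin Q
    kind   : Fin Q → Kind
    δ      : Fin Q → Sym → Sym → List (Fin Q × Sym × Move × Sym × Move)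
    answer : Fin Q → Bool → Fin Q
open OTM public

record Config (M : OTM) : Set where
  constructor config
  field
    state  : Fin (Q M)
    work   : Tape
    oracle : Tape
open Config public

toSyms : List Bool → List Sym
toSyms = map bit

inputTape : List Bool → Tape
inputTape []       = blankTape
inputTape (b ∷ bs) = tape [] (bit b) (toSyms bs)

initConfig : (M : OTM) → List Bool → Config M
initConfig M x = config (start M) (inputTape x) blankTape

data Step (M : OTM) : Set where
  halt   : Bool → Step M               -- accept (true) / reject (false)
  branch : List (Config M) → Step M

applyTr : {M : OTM} → Config M → Fin (Q M) × Sym × Move × Sym × Move → Config M
applyTr (config _ w o) (q , sw , mw , so , mo) = config q (writeMove sw mw w) (writeMove so mo o)

stepK : (D : Oracle) (M : OTM) → Kind → Config M → Step M
stepK D M normal c = branch (map (applyTr c) (δ M (state c) (here (work c)) (here (oracle c))))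
stepK D M query  c = branch (config (answer M (state c) (D (tapeBits (oracle c)))) (work c) blankTape ∷ [])
stepK D M accept c = halt true
stepK D M reject c = halt false

step : (D : Oracle) (M : OTM) → Config M → Step M
step D M c = stepK D M (kind M (state c)) c

mutual
  HaltsWithin : (D : Oracle) (M : OTM) → ℕ → Config M → Set
  HaltsWithin D M t c = HaltsWithinS D M t (step D M c)

  HaltsWithinS : (D : Oracle) (M : OTM) → ℕ → Step M → Set
  HaltsWithinS D M t       (halt _)    = ⊤
  HaltsWithinS D M zero    (branch _)  = ⊥
  HaltsWithinS D M (suc t) (branch cs) = HaltsWithinL D M t cs

  HaltsWithinL : (D : Oracle) (M : OTM) → ℕ → List (Config M) → Set
  HaltsWithinL D M t []       = ⊤
  HaltsWithinL D M t (c ∷ cs) = HaltsWithin D M t c × HaltsWithinL D M t cs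

mutual
  accCount : (D : Oracle) (M : OTM) → ℕ → Config M → ℕ
  accCount D M t c = accCountS D M t (step D M c)

  accCountS : (D : Oracle) (M : OTM) → ℕ → Step M → ℕ
  accCountS D M t       (halt true)  = 1
  accCountS D M t       (halt false) = 0
  accCountS D M zero    (branch _)   = 0
  accCountS D M (suc t) (branch cs)  = accCountL D M t cs

  accCountL : (D : Oracle) (M : OTM) → ℕ → List (Config M) → ℕ
  accCountL D M t []       = 0
  accCountL D M t (c ∷ cs) = accCount D M t c + accCountL D M t cs

IsDeterministic : OTM → Set
IsDeterministic M = ∀ q a b → length (δ M q a b) ≤ 1

mutual
  run : (D : Oracle) (M : OTM) → ℕ → Config M → Maybe (Config M)
  run D M t c = runS D M t c (step D M c)

  runS : (D : Oracle) (M : OTM) → ℕ → Config M → Step M → Maybe (Config M)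
  runS D M t       c (halt _)           = just c
  runS D M zero    c (branch _)         = nothing
  runS D M (suc t) c (branch [])        = nothing
  runS D M (suc t) c (branch (c' ∷ _))  = run D M t c'

readOut : Sym → List Sym → List Bool
readOut blank   _        = []
readOut (bit b) []       = b ∷ []
readOut (bit b) (s ∷ ss) = b ∷ readOut s ss

output : {M : OTM} → Config M → List Bool
output c = readOut (here (work c)) (right (work c))

-- Binary representation of natural numbers (least significant bit first,
-- no leading zeros; 0 is the empty string).
incBits : List Bool → List Bool
incBits []           = true ∷ []
incBits (false ∷ bs) = true ∷ bs
incBits (true ∷ bs)  = false ∷ incBits bs

bits : ℕ → List Bool
bits zero    = []
bits (suc n) = incBits (bits n)

poly : ℕ → ℕ → ℕ
poly k n = n ^ k + k

unary : ℕ → List Bool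
unary n = replicate n true

SharpP : Oracle → (List Bool → ℕ) → Set
SharpP D f = Σ OTM λ M → Σ ℕ λ k → ∀ x →
  HaltsWithin D M (poly k (length x)) (initConfig M x)
  × accCount D M (poly k (length x)) (initConfig M x) ≡ f x

SharpP₁ : Oracle → (ℕ → ℕ) → Set
SharpP₁ D f = Σ OTM λ M → Σ ℕ λ k → ∀ n →
  HaltsWithin D M (poly k n) (initConfig M (unary n))
  × accCount D M (poly k n) (initConfig M (unary n)) ≡ f n

FP : Oracle → (List Bool → List Bool) → Set
FP D g = Σ OTM λ T → IsDeterministic T × Σ ℕ λ k → ∀ x →
  Maybe.map output (run D T (poly k (length x)) (initConfig T x)) ≡ just (g x)

FPUnary : Oracle → (ℕ → ℕ) → Set
FPUnary D f = Σ OTM λ T → IsDeterministic T × Σ ℕ λ k → ∀ n →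
  Maybe.map output (run D T (poly k n) (initConfig T (unary n))) ≡ just (bits (f n))

{-# OPTIONS --safe #-}
-- A free set F of strings is closed off to an oracle D: strings 0w carry F w, and strings 1w with
-- w = 1^e 0^(i+1) 1^(n+1) 0^m answer questions about the e-th unary counting machine on input 1ⁿ with respect to D
-- restricted to strings shorter than m.  A transducer can therefore read off the digits of any unary
-- counting function, once it has padded its queries beyond the running time of the counting machine.
--
-- The strings 1w of length at most t have only polynomially many different answers, i.e. they act as
-- polynomially many bits of advice.  The function f x = #{y : |y| = |x|, F (interleaving of x and y)} is not
-- computable with so little advice on all x of a suitable length, by a counting argument, so F can be
-- chosen in stages, one for each transducer and time bound, to make f hard.
module Submission where

open import Defs
open import Data.Bool using (Bool; true; false; _∨_; _xor_; if_then_else_; T)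
import Data.Bool.Properties as Bool
open import Data.Empty using (⊥; ⊥-elim)
open import Data.Fin using (Fin; zero; suc; toℕ; inject₁; inject≤; splitAt; join; combine; remQuot; finToFun; funToFin)
import Data.Fin.Properties as Fin
open import Data.Fin.Properties using (any?; ¬∀⟶∃¬; injective⇒≤; combine-injective; combine-remQuot; remQuot-combine; finToFun-funToFin; funToFin-finToFin; toℕ-inject₁; splitAt-join; inject≤-injective)
open import Data.List using (List; []; _∷_; length; map; reverse; _++_; _ʳ++_; replicate; lookup; tabulate)
open import Data.List.Properties using (length-++; length-replicate; length-reverse; length-tabulate; ++-assoc; ++-identityʳ; reverse-injective; unfold-reverse; ≡-dec; ∷-injectiveˡ; ∷-injectiveʳ)
open import Data.List.Membership.Propositional using (_∈_; _∉_)
open import Data.List.Membership.Propositional.Properties using (∈-++⁺ˡ; ∈-++⁺ʳ)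
open import Data.List.Membership.DecPropositional (≡-dec Bool._≟_) using (_∈?_)
import Data.List.Relation.Unary.Any as Any
open import Data.List.Relation.Unary.Any.Properties using (lookup-index)
open import Data.Maybe using (Maybe; just)
import Data.Maybe as Maybe
import Data.Maybe.Properties as Maybe
open import Data.Nat using (ℕ; zero; suc; pred; _+_; _*_; _^_; _⊔_; _≤_; _<_; _<ᵇ_; z≤n; s≤s)
open import Data.Nat.Properties
open import Data.Nat.Tactic.RingSolver using (solve-∀)
open import Data.Product using (Σ; ∃; _×_; _,_; proj₁; proj₂; uncurry)
import Data.Product as Product
open import Data.Sum using (_⊎_; inj₁; inj₂)
import Data.Sum as Sum
open import Data.Unit using (tt)
open import Function using (_∘_; Inverse; Injective)
open import Relation.Binary.Definitions using (DecidableEquality)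
open import Relation.Binary.PropositionalEquality
open import Relation.Nullary using (¬_; Dec; yes; no; contradiction; does; ¬?; _×-dec_)
open import Relation.Nullary.Decidable using (decidable-stable)

-- Polynomial bounds and binary notation

-- The cut-off m is written in unary inside the query, so a question is longer than every string it
-- can inspect; this is why the self-reference is well-founded. Unary inputs matter for the advice
-- count: a question is determined by four numbers bounded by its length, so (t+1)^4 bits record all
-- answers up to length t, whereas binary inputs would give exponentially many questions. The
-- obstacle is that these bits are not fixed. They depend on F, hence on the very cells one would
-- change to fool a transducer, and a single value f x could well be hidden in them. So K inputs,
-- one more than the number of advice bits, are treated together. All K runs read fewer than 2^n
-- cells, so every row keeps an unread cell, and flipping these cells gives K independent bits, too
-- many for the advice to hold. Counting, unlike mere existence, makes f x depend on each single
-- cell of its row, so a correct value determines the unread bit once the rest of the row is known.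

PolyBounded : (ℕ → ℕ) → Set
PolyBounded g = Σ ℕ λ k → ∀ n → g n ≤ poly k n

n<2^n : ∀ n → n < 2 ^ n
n<2^n zero    = s≤s z≤n
n<2^n (suc n) = begin
  suc (suc n)      ≤⟨ +-mono-≤ (m^n>0 2 n) (n<2^n n) ⟩
  2 ^ n + 2 ^ n    ≡⟨ cong (2 ^ n +_) (sym (+-identityʳ _)) ⟩
  2 ^ suc n        ∎
  where open ≤-Reasoning

poly≤^ : ∀ k n → 2 ≤ n → poly k n ≤ n ^ suc k
poly≤^ k n 2≤n = begin
  n ^ k + k          ≤⟨ +-monoʳ-≤ (n ^ k) (≤-trans (<⇒≤ (n<2^n k)) (^-monoˡ-≤ k 2≤n)) ⟩
  n ^ k + n ^ k      ≡⟨ cong (n ^ k +_) (sym (+-identityʳ _)) ⟩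
  2 * n ^ k          ≤⟨ *-monoˡ-≤ (n ^ k) 2≤n ⟩
  n ^ suc k          ∎
  where open ≤-Reasoning

poly≤suc : ∀ k n → n ≤ 1 → poly k n ≤ suc k
poly≤suc k n n≤1 = +-monoˡ-≤ k (≤-trans (^-monoˡ-≤ k n≤1) (≤-reflexive (^-zeroˡ k)))

^-monoʳ-≤′ : ∀ {n a b} → 2 ≤ n → a ≤ b → n ^ a ≤ n ^ b
^-monoʳ-≤′ {suc n} _ a≤b = ^-monoʳ-≤ (suc n) a≤b

-- For n at most 1 the powers of n do not grow, so the additive constant of `poly` must do the work;
-- for n at least 2 constant factors are absorbed into further powers of n.
polyBounded-by-cases : ∀ {g} c d → (∀ n → n ≤ 1 → g n ≤ c) → (∀ n → 2 ≤ n → g n ≤ n ^ d) → PolyBounded g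
polyBounded-by-cases {g} c d small large = c + d , bound
  where
  bound : ∀ n → g n ≤ poly (c + d) n
  bound n with ≤-total n 1
  ... | inj₁ n≤1 = ≤-trans (small n n≤1) (≤-trans (m≤m+n c d) (m≤n+m (c + d) (n ^ (c + d))))
  ... | inj₂ 1≤n with m≤n⇒m<n∨m≡n 1≤n
  ...   | inj₁ 2≤n  = ≤-trans (large n 2≤n) (≤-trans (^-monoʳ-≤′ 2≤n (m≤n+m d c)) (m≤m+n _ (c + d)))
  ...   | inj₂ refl = ≤-trans (small 1 (s≤s z≤n)) (≤-trans (m≤m+n c d) (m≤n+m (c + d) (1 ^ (c + d))))

abstract
  polyBounded-const : ∀ c → PolyBounded (λ _ → c)
  polyBounded-const c = c , λ n → m≤n+m c (n ^ c)

  polyBounded-id : PolyBounded (λ n → n)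
  polyBounded-id = 1 , λ n → ≤-trans (≤-reflexive (sym (*-identityʳ n))) (m≤m+n _ 1)

  polyBounded-poly : ∀ k → PolyBounded (poly k)
  polyBounded-poly k = k , λ n → ≤-refl

  polyBounded-+ : ∀ {g h} → PolyBounded g → PolyBounded h → PolyBounded (λ n → g n + h n)
  polyBounded-+ {g} {h} (a , ga) (b , hb) = polyBounded-by-cases (suc a + suc b) (suc (suc a + suc b))
    (λ n n≤1 → +-mono-≤ (≤-trans (ga n) (poly≤suc a n n≤1)) (≤-trans (hb n) (poly≤suc b n n≤1)))
    large
    where
    open ≤-Reasoning
    large : ∀ n → 2 ≤ n → g n + h n ≤ n ^ suc (suc a + suc b)
    large n 2≤n = begin
      g n + h n                                ≤⟨ +-mono-≤ (≤-trans (ga n) (poly≤^ a n 2≤n)) (≤-trans (hb n) (poly≤^ b n 2≤n)) ⟩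
      n ^ suc a + n ^ suc b                    ≤⟨ +-mono-≤ (^-monoʳ-≤′ 2≤n (m≤m+n (suc a) (suc b))) (^-monoʳ-≤′ 2≤n (m≤n+m (suc b) (suc a))) ⟩
      n ^ (suc a + suc b) + n ^ (suc a + suc b) ≡⟨ cong (n ^ (suc a + suc b) +_) (sym (+-identityʳ _)) ⟩
      2 * n ^ (suc a + suc b)                  ≤⟨ *-monoˡ-≤ (n ^ (suc a + suc b)) 2≤n ⟩
      n ^ suc (suc a + suc b)                  ∎

  polyBounded-* : ∀ {g h} → PolyBounded g → PolyBounded h → PolyBounded (λ n → g n * h n)
  polyBounded-* {g} {h} (a , ga) (b , hb) = polyBounded-by-cases (suc a * suc b) (suc a + suc b)
    (λ n n≤1 → *-mono-≤ (≤-trans (ga n) (poly≤suc a n n≤1)) (≤-trans (hb n) (poly≤suc b n n≤1)))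
    (λ n 2≤n → ≤-trans
       (*-mono-≤ (≤-trans (ga n) (poly≤^ a n 2≤n)) (≤-trans (hb n) (poly≤^ b n 2≤n)))
       (≤-reflexive (sym (^-distribˡ-+-* n (suc a) (suc b)))))

linear<2^ : ∀ k j → k ≤ j → 2 * j * k < 2 ^ (2 * j)
linear<2^ k j k≤j = begin-strict
  2 * j * k                ≤⟨ *-monoʳ-≤ (2 * j) k≤j ⟩
  2 * j * j                <⟨ lem j ⟩
  2 ^ (2 * j)              ∎
  where
  open ≤-Reasoning
  lem : ∀ j → 2 * j * j < 2 ^ (2 * j)
  lem zero          = s≤s z≤n
  lem (suc zero)    = s≤s (s≤s (s≤s z≤n))
  lem (suc (suc j)) = begin-strict
    2 * i * i                     ≡⟨ *-assoc 2 i i ⟩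
    2 * (i * i)                   ≤⟨ *-monoʳ-≤ 2 (*-monoˡ-≤ i (n<2^n (suc j))) ⟩
    2 * (2 ^ suc j * i)           <⟨ *-monoʳ-< 2 (*-monoʳ-< (2 ^ suc j) {{m^n≢0 2 (suc j)}} (n<2^n i)) ⟩
    2 * (2 ^ suc j * 2 ^ i)       ≡⟨ sym (*-assoc 2 (2 ^ suc j) (2 ^ i)) ⟩
    2 ^ i * 2 ^ i                 ≡⟨ sym (^-distribˡ-+-* 2 i i) ⟩
    2 ^ (i + i)                   ≡⟨ cong (λ z → 2 ^ (i + z)) (sym (+-identityʳ i)) ⟩
    2 ^ (2 * i)                   ∎
    where
    i = suc (suc j)

-- With n = 2^m the power n^(k+1) becomes 2^(m(k+1)), so only m(k+1) < 2^m is needed. The choice m =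
-- 2j with j = k+1+n₀ makes m large enough for this and for n₀.
exp-dominates : ∀ {g} → PolyBounded g → ∀ n₀ → Σ ℕ λ n → n₀ ≤ n × g n < 2 ^ n
exp-dominates {g} (k , gk) n₀ = 2 ^ m , n₀≤n , (begin-strict
  g (2 ^ m)              ≤⟨ gk (2 ^ m) ⟩
  poly k (2 ^ m)         ≤⟨ poly≤^ k (2 ^ m) (^-monoʳ-≤ 2 {1} {m} (s≤s z≤n)) ⟩
  (2 ^ m) ^ suc k        ≡⟨ ^-*-assoc 2 m (suc k) ⟩
  2 ^ (m * suc k)        <⟨ ^-monoʳ-< 2 (s≤s (s≤s z≤n)) (linear<2^ (suc k) j (m≤m+n (suc k) n₀)) ⟩
  2 ^ (2 ^ m)            ∎)
  where
  open ≤-Reasoning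
  j = suc k + n₀
  m = 2 * j
  n₀≤n : n₀ ≤ 2 ^ m
  n₀≤n = ≤-trans (m≤n+m n₀ (suc k)) (≤-trans (m≤m+n j (j + 0)) (<⇒≤ (n<2^n m)))

bitsVal : List Bool → ℕ
bitsVal []           = 0
bitsVal (false ∷ bs) = 2 * bitsVal bs
bitsVal (true ∷ bs)  = suc (2 * bitsVal bs)

bitsVal-incBits : ∀ bs → bitsVal (incBits bs) ≡ suc (bitsVal bs)
bitsVal-incBits []           = refl
bitsVal-incBits (false ∷ bs) = refl
bitsVal-incBits (true ∷ bs)  = trans (cong (2 *_) (bitsVal-incBits bs)) (*-suc 2 (bitsVal bs))

bitsVal-bits : ∀ n → bitsVal (bits n) ≡ n
bitsVal-bits zero    = refl
bitsVal-bits (suc n) = trans (bitsVal-incBits (bits n)) (cong suc (bitsVal-bits n))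

bits-injective : ∀ {m n} → bits m ≡ bits n → m ≡ n
bits-injective {m} {n} eq = trans (sym (bitsVal-bits m)) (trans (cong bitsVal eq) (bitsVal-bits n))

-- The least significant digit comes first, so `msb` forbids a zero in the last place. Only then
-- does the value bound the length of a numeral.
data Normal : List Bool → Set where
  []   : Normal []
  msb  : Normal (true ∷ [])
  cons : ∀ b {c bs} → Normal (c ∷ bs) → Normal (b ∷ c ∷ bs)

incBits-normal : ∀ {bs} → Normal bs → Normal (incBits bs)
incBits-normal []                       = msb
incBits-normal msb                      = cons false msb
incBits-normal (cons false nb)          = cons true nb
incBits-normal {true ∷ c ∷ bs} (cons true nb) with incBits (c ∷ bs) | incBits-normal nb | bitsVal-incBits (c ∷ bs)
-- An incremented numeral has positive value, so it is not empty.
... | []     | _   | ()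
... | d ∷ ds | nds | _ = cons false nds

bits-normal : ∀ n → Normal (bits n)
bits-normal zero    = []
bits-normal (suc n) = incBits-normal (bits-normal n)

normal-length : ∀ {b bs} → Normal (b ∷ bs) → 2 ^ length bs ≤ bitsVal (b ∷ bs)
normal-length msb            = s≤s z≤n
normal-length (cons false n) = *-monoʳ-≤ 2 (normal-length n)
normal-length (cons true n)  = m≤n⇒m≤1+n (*-monoʳ-≤ 2 (normal-length n))

length-bits : ∀ v ℓ → v < 2 ^ ℓ → length (bits v) ≤ ℓ
length-bits v ℓ v< with bits v | bits-normal v | bitsVal-bits v
... | []     | _  | _    = z≤n
... | b ∷ bs | nb | refl = ^-cancel-< (length bs) ℓ (≤-<-trans (normal-length nb) v<)
  where
  ^-cancel-< : ∀ a b → 2 ^ a < 2 ^ b → a < b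
  ^-cancel-< a b lt with a <? b
  ... | yes p = p
  ... | no ¬p = contradiction lt (≤⇒≯ (^-monoʳ-≤ 2 (≮⇒≥ ¬p)))

-- Locality of oracle computations

AgreeUpTo : ℕ → Oracle → Oracle → Set
AgreeUpTo n O O′ = ∀ s → length s ≤ n → O s ≡ O′ s

AgreeUpTo-≤ : ∀ {m n O O′} → m ≤ n → AgreeUpTo n O O′ → AgreeUpTo m O O′
AgreeUpTo-≤ m≤n ag s s≤m = ag s (≤-trans s≤m m≤n)

symWeight : Sym → ℕ
symWeight blank   = 0
symWeight (bit _) = 1

symsWeight : List Sym → ℕ
symsWeight []       = 0
symsWeight (x ∷ xs) = symWeight x + symsWeight xs

symWeight≤1 : ∀ x → symWeight x ≤ 1
symWeight≤1 blank   = z≤n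
symWeight≤1 (bit _) = s≤s z≤n

length-symsBits : ∀ xs → length (symsBits xs) ≡ symsWeight xs
length-symsBits []           = refl
length-symsBits (blank ∷ xs) = length-symsBits xs
length-symsBits (bit _ ∷ xs) = cong suc (length-symsBits xs)

symsWeight-++ : ∀ xs ys → symsWeight (xs ++ ys) ≡ symsWeight xs + symsWeight ys
symsWeight-++ []       ys = refl
symsWeight-++ (x ∷ xs) ys = trans (cong (symWeight x +_) (symsWeight-++ xs ys)) (sym (+-assoc (symWeight x) _ _))

symsWeight-reverse : ∀ xs → symsWeight (reverse xs) ≡ symsWeight xs
symsWeight-reverse []       = refl
symsWeight-reverse (x ∷ xs) = begin
  symsWeight (reverse (x ∷ xs))              ≡⟨ cong symsWeight (unfold-reverse x xs) ⟩
  symsWeight (reverse xs ++ x ∷ [])          ≡⟨ symsWeight-++ (reverse xs) (x ∷ []) ⟩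
  symsWeight (reverse xs) + (symWeight x + 0) ≡⟨ cong₂ _+_ (symsWeight-reverse xs) (+-identityʳ _) ⟩
  symsWeight xs + symWeight x                ≡⟨ +-comm (symsWeight xs) _ ⟩
  symWeight x + symsWeight xs                ∎
  where open ≡-Reasoning

length-tapeBits : ∀ l h r → length (tapeBits (tape l h r)) ≡ symsWeight l + (symWeight h + symsWeight r)
length-tapeBits l h r = trans (length-symsBits (reverse l ++ h ∷ r))
  (trans (symsWeight-++ (reverse l) (h ∷ r)) (cong (_+ (symWeight h + symsWeight r)) (symsWeight-reverse l)))

-- A move merely shifts cells between the lists, so only the one rewritten cell can add a bit. Bits
-- and not cells are counted because `tapeBits` drops blanks.
length-tapeBits-writeMove : ∀ s m τ → length (tapeBits (writeMove s m τ)) ≤ suc (length (tapeBits τ))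
length-tapeBits-writeMove s m τ@(tape l h r) rewrite length-tapeBits l h r = weight m l r
  where
  open ≤-Reasoning
  drop-here : ∀ a b → symWeight s + (a + b) ≤ suc (a + (symWeight h + b))
  drop-here a b = +-mono-≤ (symWeight≤1 s) (+-monoʳ-≤ a (m≤n+m b (symWeight h)))
  rotateL : ∀ a c d b → a + (c + (d + b)) ≡ d + ((c + a) + b)
  rotateL = solve-∀
  rotateR : ∀ a c d b → (d + a) + (c + b) ≡ d + (a + (c + b))
  rotateR = solve-∀
  weight : ∀ m l r → length (tapeBits (writeMove s m (tape l h r))) ≤ suc (symsWeight l + (symWeight h + symsWeight r))
  weight L [] r = begin
    length (tapeBits (tape [] blank (s ∷ r)))  ≡⟨ length-tapeBits [] blank (s ∷ r) ⟩
    symWeight s + symsWeight r                 ≤⟨ drop-here 0 (symsWeight r) ⟩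
    suc (symWeight h + symsWeight r)           ∎
  weight L (x ∷ l) r = begin
    length (tapeBits (tape l x (s ∷ r)))       ≡⟨ length-tapeBits l x (s ∷ r) ⟩
    symsWeight l + (symWeight x + (symWeight s + symsWeight r))
                                               ≡⟨ rotateL (symsWeight l) (symWeight x) (symWeight s) (symsWeight r) ⟩
    symWeight s + (symsWeight (x ∷ l) + symsWeight r)
                                               ≤⟨ drop-here (symsWeight (x ∷ l)) (symsWeight r) ⟩
    suc (symsWeight (x ∷ l) + (symWeight h + symsWeight r)) ∎
  weight R l [] = begin
    length (tapeBits (tape (s ∷ l) blank []))  ≡⟨ length-tapeBits (s ∷ l) blank [] ⟩
    symWeight s + symsWeight l + 0             ≡⟨ +-assoc (symWeight s) (symsWeight l) 0 ⟩
    symWeight s + (symsWeight l + 0)           ≤⟨ drop-here (symsWeight l) 0 ⟩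
    suc (symsWeight l + (symWeight h + 0))     ∎
  weight R l (x ∷ r) = begin
    length (tapeBits (tape (s ∷ l) x r))       ≡⟨ length-tapeBits (s ∷ l) x r ⟩
    symsWeight (s ∷ l) + (symWeight x + symsWeight r)
                                               ≡⟨ rotateR (symsWeight l) (symWeight x) (symWeight s) (symsWeight r) ⟩
    symWeight s + (symsWeight l + symsWeight (x ∷ r))
                                               ≤⟨ drop-here (symsWeight l) (symsWeight (x ∷ r)) ⟩
    suc (symsWeight l + (symWeight h + symsWeight (x ∷ r))) ∎
  weight S l r = begin
    length (tapeBits (tape l s r))             ≡⟨ length-tapeBits l s r ⟩
    symsWeight l + (symWeight s + symsWeight r) ≡⟨ rotateL (symsWeight l) 0 (symWeight s) (symsWeight r) ⟩
    symWeight s + (symsWeight l + symsWeight r) ≤⟨ drop-here (symsWeight l) (symsWeight r) ⟩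
    suc (symsWeight l + (symWeight h + symsWeight r)) ∎

queryLength : ∀ {M} → Config M → ℕ
queryLength c = length (tapeBits (oracle c))

-- Bits on the query tape plus remaining time never increase. This potential is the induction
-- invariant below: a run of time t from a blank query tape only asks strings of length at most t.
queryLength-applyTr : ∀ {M} (c : Config M) tr t → queryLength (applyTr c tr) + t ≤ queryLength c + suc t
queryLength-applyTr (config _ _ o) (_ , _ , _ , so , mo) t =
  ≤-trans (+-monoˡ-≤ t (length-tapeBits-writeMove so mo o)) (≤-reflexive (sym (+-suc _ t)))

module _ {O O′ : Oracle} (M : OTM) where

  -- The second of the three functions takes the kind as a separate argument, so that a case split
  -- on it makes `stepK` reduce under both oracles at once.
  accCount-local : ∀ t c → AgreeUpTo (queryLength c + t) O O′ → accCount O M t c ≡ accCount O′ M t c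
  accCountS-local : ∀ κ t c → AgreeUpTo (queryLength c + t) O O′ →
                    accCountS O M t (stepK O M κ c) ≡ accCountS O′ M t (stepK O′ M κ c)
  accCountL-local : ∀ t c trs → AgreeUpTo (queryLength c + suc t) O O′ →
                    accCountL O M t (map (applyTr c) trs) ≡ accCountL O′ M t (map (applyTr c) trs)

  accCount-local t c ag = accCountS-local (kind M (state c)) t c ag

  accCountS-local normal zero    c ag = refl
  accCountS-local normal (suc t) c ag = accCountL-local t c (δ M (state c) (here (work c)) (here (oracle c))) ag
  accCountS-local query  zero    c ag = refl
  accCountS-local query  (suc t) c ag
    rewrite ag (tapeBits (oracle c)) (m≤m+n _ (suc t))
    = cong (_+ 0) (accCount-local t _ (AgreeUpTo-≤ (≤-trans (n≤1+n t) (m≤n+m (suc t) (queryLength c))) ag))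
  accCountS-local accept t c ag = refl
  accCountS-local reject t c ag = refl

  accCountL-local t c []         ag = refl
  accCountL-local t c (tr ∷ trs) ag =
    cong₂ _+_ (accCount-local t (applyTr c tr) (AgreeUpTo-≤ (queryLength-applyTr c tr t) ag)) (accCountL-local t c trs ag)

  run-local : ∀ t c → AgreeUpTo (queryLength c + t) O O′ → run O M t c ≡ run O′ M t c
  runS-local : ∀ κ t c → AgreeUpTo (queryLength c + t) O O′ →
               runS O M t c (stepK O M κ c) ≡ runS O′ M t c (stepK O′ M κ c)

  run-local t c ag = runS-local (kind M (state c)) t c ag

  runS-local normal zero    c ag = refl
  runS-local normal (suc t) c ag with δ M (state c) (here (work c)) (here (oracle c))
  ... | []     = refl
  ... | tr ∷ _ = run-local t (applyTr c tr) (AgreeUpTo-≤ (queryLength-applyTr c tr t) ag)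
  runS-local query  zero    c ag = refl
  runS-local query  (suc t) c ag
    rewrite ag (tapeBits (oracle c)) (m≤m+n _ (suc t))
    = run-local t _ (AgreeUpTo-≤ (≤-trans (n≤1+n t) (m≤n+m (suc t) (queryLength c))) ag)
  runS-local accept t c ag = refl
  runS-local reject t c ag = refl

-- Query lists of deterministic runs

module _ (M : OTM) where

  queries  : Oracle → ℕ → Config M → List (List Bool)
  queriesK : Oracle → Kind → ℕ → Config M → List (List Bool)
  queriesL : Oracle → ℕ → Config M → List (Fin (Q M) × Sym × Move × Sym × Move) → List (List Bool)

  queries O zero    c = []
  queries O (suc t) c = queriesK O (kind M (state c)) t c

  queriesK O normal t c = queriesL O t c (δ M (state c) (here (work c)) (here (oracle c)))
  queriesK O query  t c = tapeBits (oracle c) ∷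
    queries O t (config (answer M (state c) (O (tapeBits (oracle c)))) (work c) blankTape)
  queriesK O accept t c = []
  queriesK O reject t c = []

  queriesL O t c []       = []
  queriesL O t c (tr ∷ _) = queries O t (applyTr c tr)

  length-queries  : ∀ O t c → length (queries O t c) ≤ t
  length-queriesK : ∀ O κ t c → length (queriesK O κ t c) ≤ suc t

  length-queries O zero    c = z≤n
  length-queries O (suc t) c = length-queriesK O (kind M (state c)) t c

  length-queriesK O normal t c with δ M (state c) (here (work c)) (here (oracle c))
  ... | []     = z≤n
  ... | tr ∷ _ = m≤n⇒m≤1+n (length-queries O t (applyTr c tr))
  length-queriesK O query  t c = s≤s (length-queries O t _)
  length-queriesK O accept t c = z≤n
  length-queriesK O reject t c = z≤n

  module _ {O O′ : Oracle} where

    -- Equality of the query lists, and not only of the results, is what later allows the unread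
    -- cells to be recovered from a modified oracle.
    queries-determine-run : ∀ t c → (∀ s → s ∈ queries O t c → O s ≡ O′ s) →
      queries O t c ≡ queries O′ t c × run O M t c ≡ run O′ M t c
    queriesK-determine-run : ∀ κ t c → (∀ s → s ∈ queriesK O κ t c → O s ≡ O′ s) →
      queriesK O κ t c ≡ queriesK O′ κ t c × runS O M (suc t) c (stepK O M κ c) ≡ runS O′ M (suc t) c (stepK O′ M κ c)

    queries-determine-run zero c ag with kind M (state c)
    ... | normal = refl , refl
    ... | query  = refl , refl
    ... | accept = refl , refl
    ... | reject = refl , refl
    queries-determine-run (suc t) c ag = queriesK-determine-run (kind M (state c)) t c ag

    queriesK-determine-run normal t c ag with δ M (state c) (here (work c)) (here (oracle c))
    ... | []     = refl , refl
    ... | tr ∷ _ = queries-determine-run t (applyTr c tr) ag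
    queriesK-determine-run query t c ag
      with O (tapeBits (oracle c)) | O′ (tapeBits (oracle c)) | ag (tapeBits (oracle c)) (Any.here refl)
         | queries-determine-run t (config (answer M (state c) (O (tapeBits (oracle c)))) (work c) blankTape) (λ s s∈ → ag s (Any.there s∈))
    ... | b | .b | refl | eq , eq′ = cong (tapeBits (oracle c) ∷_) eq , eq′
    queriesK-determine-run accept t c ag = refl , refl
    queriesK-determine-run reject t c ag = refl , refl

-- Bounds on the number of accepting paths

Branching : ℕ → OTM → Set
Branching b M = ∀ q x y → length (δ M q x y) ≤ b

module _ (O : Oracle) (M : OTM) {b : ℕ} (bounded : Branching b M) where

  -- The base is `suc b` because for b = 0 the powers of b would vanish at positive t, while an
  -- accepting configuration counts 1 and a query step always has a successor.
  accCount-bound  : ∀ t c → accCount O M t c ≤ suc b ^ t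
  accCountS-bound : ∀ κ t c → accCountS O M t (stepK O M κ c) ≤ suc b ^ t
  accCountL-bound : ∀ t c trs → accCountL O M t (map (applyTr c) trs) ≤ length trs * suc b ^ t

  accCount-bound t c = accCountS-bound (kind M (state c)) t c

  accCountS-bound normal zero    c = z≤n
  accCountS-bound normal (suc t) c = ≤-trans (accCountL-bound t c (δ M (state c) (here (work c)) (here (oracle c))))
    (*-monoˡ-≤ (suc b ^ t) (m≤n⇒m≤1+n (bounded (state c) (here (work c)) (here (oracle c)))))
  accCountS-bound query  zero    c = z≤n
  accCountS-bound query  (suc t) c = ≤-trans (≤-reflexive (+-identityʳ _)) (≤-trans (accCount-bound t _) (m≤m+n _ (b * suc b ^ t)))
  accCountS-bound accept t c = m^n>0 (suc b) t
  accCountS-bound reject t c = z≤n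

  accCountL-bound t c []         = z≤n
  accCountL-bound t c (tr ∷ trs) = +-mono-≤ (accCount-bound t (applyTr c tr)) (accCountL-bound t c trs)

  length-bits-accCount : ∀ t c → length (bits (accCount O M t c)) ≤ suc (suc b * t)
  length-bits-accCount t c = length-bits _ _ (begin-strict
    accCount O M t c      ≤⟨ accCount-bound t c ⟩
    suc b ^ t             ≤⟨ ^-monoˡ-≤ t (<⇒≤ (n<2^n (suc b))) ⟩
    (2 ^ suc b) ^ t       ≡⟨ ^-*-assoc 2 (suc b) t ⟩
    2 ^ (suc b * t)       <⟨ ^-monoʳ-< 2 (s≤s (s≤s z≤n)) (n<1+n (suc b * t)) ⟩
    2 ^ suc (suc b * t)   ∎)
    where open ≤-Reasoning

fin-bounded : ∀ {n} (g : Fin n → ℕ) → Σ ℕ λ b → ∀ i → g i ≤ b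
fin-bounded {zero}  g = 0 , λ ()
fin-bounded {suc n} g with fin-bounded (λ i → g (suc i))
... | b , gb = g zero ⊔ b , λ { zero → m≤m⊔n (g zero) b ; (suc i) → ≤-trans (gb i) (m≤n⊔m (g zero) b) }

sym-bounded : ∀ (g : Sym → ℕ) → Σ ℕ λ b → ∀ x → g x ≤ b
sym-bounded g = g blank + (g (bit false) + g (bit true)) , λ
  { blank       → m≤m+n _ _
  ; (bit false) → ≤-trans (m≤m+n _ (g (bit true))) (m≤n+m _ (g blank))
  ; (bit true)  → ≤-trans (m≤n+m _ (g (bit false))) (m≤n+m _ (g blank)) }

finite-branching : ∀ M → Σ ℕ λ b → Branching b M
finite-branching M = proj₁ B , λ q x y → ≤-trans (proj₂ (by-sym q x) y) (≤-trans (proj₂ (by-state q) x) (proj₂ B q))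
  where
  by-sym   = λ q x → sym-bounded (λ y → length (δ M q x y))
  by-state = λ q → sym-bounded (λ x → proj₁ (by-sym q x))
  B        = fin-bounded (λ q → proj₁ (by-state q))

-- Machines with pointwise equal tables

data _≈ᴹ_ : OTM → OTM → Set where
  pointwise : ∀ {q s κ κ′ d d′ a a′} → (∀ i → κ i ≡ κ′ i) → (∀ i x y → d i x y ≡ d′ i x y) → (∀ i b → a i b ≡ a′ i b) →
    record { Q = q ; start = s ; kind = κ ; δ = d ; answer = a } ≈ᴹ
    record { Q = q ; start = s ; kind = κ′ ; δ = d′ ; answer = a′ }

module _ (O : Oracle) {q : ℕ} {s : Fin q} {κ κ′ : Fin q → Kind}
         {d d′ : Fin q → Sym → Sym → List (Fin q × Sym × Move × Sym × Move)} {a a′ : Fin q → Bool → Fin q}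
         (eκ : ∀ i → κ i ≡ κ′ i) (ed : ∀ i x y → d i x y ≡ d′ i x y) (ea : ∀ i b → a i b ≡ a′ i b) where

  private
    M M′ : OTM
    M  = record { Q = q ; start = s ; kind = κ ; δ = d ; answer = a }
    M′ = record { Q = q ; start = s ; kind = κ′ ; δ = d′ ; answer = a′ }

    cast : Config M → Config M′
    cast (config i w o) = config i w o

    count  : ∀ t c → accCount O M t c ≡ accCount O M′ t (cast c)
    countS : ∀ k t c → accCountS O M t (stepK O M k c) ≡ accCountS O M′ t (stepK O M′ k (cast c))
    countL : ∀ t c trs → accCountL O M t (map (applyTr c) trs) ≡ accCountL O M′ t (map (applyTr (cast c)) trs)

    count t c = trans (countS (κ (state c)) t c) (cong (λ k → accCountS O M′ t (stepK O M′ k (cast c))) (eκ (state c)))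

    countS normal zero    c = refl
    countS normal (suc t) c = trans (countL t c (d (state c) (here (work c)) (here (oracle c))))
      (cong (λ trs → accCountL O M′ t (map (applyTr (cast c)) trs)) (ed (state c) (here (work c)) (here (oracle c))))
    countS query  zero    c = refl
    countS query  (suc t) c = cong (_+ 0) (trans (count t _)
      (cong (λ i → accCount O M′ t (config i (work c) blankTape)) (ea (state c) (O (tapeBits (oracle c))))))
    countS accept t c = refl
    countS reject t c = refl

    countL t c []         = refl
    countL t c (tr ∷ trs) = cong₂ _+_ (count t (applyTr c tr)) (countL t c trs)

    outRun  : ∀ t c → Maybe.map output (run O M t c) ≡ Maybe.map output (run O M′ t (cast c))
    outRunS : ∀ k t c → Maybe.map output (runS O M t c (stepK O M k c)) ≡ Maybe.map output (runS O M′ t (cast c) (stepK O M′ k (cast c)))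
    outRunL : ∀ t c trs → Maybe.map output (runS O M (suc t) c (branch (map (applyTr c) trs)))
                        ≡ Maybe.map output (runS O M′ (suc t) (cast c) (branch (map (applyTr (cast c)) trs)))

    outRun t c = trans (outRunS (κ (state c)) t c)
      (cong (λ k → Maybe.map output (runS O M′ t (cast c) (stepK O M′ k (cast c)))) (eκ (state c)))

    outRunS normal zero    c = refl
    outRunS normal (suc t) c = trans (outRunL t c (d (state c) (here (work c)) (here (oracle c))))
      (cong (λ trs → Maybe.map output (runS O M′ (suc t) (cast c) (branch (map (applyTr (cast c)) trs))))
        (ed (state c) (here (work c)) (here (oracle c))))
    outRunS query  zero    c = refl
    outRunS query  (suc t) c = trans (outRun t _)
      (cong (λ i → Maybe.map output (run O M′ t (config i (work c) blankTape))) (ea (state c) (O (tapeBits (oracle c)))))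
    outRunS accept t c = refl
    outRunS reject t c = refl

    outRunL t c []       = refl
    outRunL t c (tr ∷ _) = outRun t (applyTr c tr)

  accCount-pointwise : ∀ t x → accCount O M t (initConfig M x) ≡ accCount O M′ t (initConfig M′ x)
  accCount-pointwise t x = count t (initConfig M x)

  run-pointwise : ∀ t x → Maybe.map output (run O M t (initConfig M x)) ≡ Maybe.map output (run O M′ t (initConfig M′ x))
  run-pointwise t x = outRun t (initConfig M x)

-- Decoding the code of a machine returns tables that are only pointwise equal to the original ones,
-- so behaviour is transported along `_≈ᴹ_` in place of equality.
accCount-≈ : ∀ O {M M′} → M ≈ᴹ M′ → ∀ t x → accCount O M t (initConfig M x) ≡ accCount O M′ t (initConfig M′ x)
accCount-≈ O (pointwise eκ ed ea) = accCount-pointwise O eκ ed ea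

run-≈ : ∀ O {M M′} → M ≈ᴹ M′ → ∀ t x →
  Maybe.map output (run O M t (initConfig M x)) ≡ Maybe.map output (run O M′ t (initConfig M′ x))
run-≈ O (pointwise eκ ed ea) = run-pointwise O eκ ed ea

-- Enumeration of machines

clamp : ∀ q → ℕ → Fin (suc q)
clamp q       zero    = zero
clamp zero    (suc n) = zero
clamp (suc q) (suc n) = suc (clamp q n)

clamp-toℕ : ∀ {q} (i : Fin (suc q)) → clamp q (toℕ i) ≡ i
clamp-toℕ         zero    = refl
clamp-toℕ {suc q} (suc i) = cong suc (clamp-toℕ i)

toℕ-clamp : ∀ {q n} → n ≤ q → toℕ (clamp q n) ≡ n
toℕ-clamp z≤n       = refl
toℕ-clamp (s≤s n≤q) = cong suc (toℕ-clamp n≤q)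

-- Cantor's walk along the antidiagonals: each starts at second component 0 and ends at first
-- component 0.
unpairNext : ℕ × ℕ → ℕ × ℕ
unpairNext (zero , b)  = suc b , zero
unpairNext (suc a , b) = a , suc b

unpair : ℕ → ℕ × ℕ
unpair zero    = zero , zero
unpair (suc n) = unpairNext (unpair n)

-- Walks backwards: (a, b+1) is preceded by (a+1, b) on the same diagonal, and (a+1, 0) by the last
-- point of the previous one.
unpair-surjective : ∀ s b a → a + b ≡ s → Σ ℕ λ n → unpair n ≡ (a , b)
unpair-surjective zero    zero    zero    _  = 0 , refl
unpair-surjective (suc s) zero    (suc a) eq with unpair-surjective s a zero (trans (sym (+-identityʳ a)) (suc-injective eq))
... | n , eq′ = suc n , cong unpairNext eq′
unpair-surjective s       (suc b) a       eq with unpair-surjective s b (suc a) (trans (sym (+-suc a b)) eq)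
... | n , eq′ = suc n , cong unpairNext eq′

record Enumeration {A : Set} (_~_ : A → A → Set) : Set where
  field
    decode        : ℕ → A
    encode        : A → ℕ
    decode-encode : ∀ a → decode (encode a) ~ a
open Enumeration

ℕ-enum : Enumeration {ℕ} _≡_
ℕ-enum = record { decode = λ n → n ; encode = λ n → n ; decode-encode = λ _ → refl }

Fin-enum : ∀ q → Enumeration {Fin (suc q)} _≡_
Fin-enum q = record { decode = clamp q ; encode = toℕ ; decode-encode = clamp-toℕ }

Sym-enum : Enumeration {Sym} _≡_
Sym-enum = record
  { decode        = λ { 0 → blank ; 1 → bit false ; _ → bit true }
  ; encode        = λ { blank → 0 ; (bit false) → 1 ; (bit true) → 2 }
  ; decode-encode = λ { blank → refl ; (bit false) → refl ; (bit true) → refl } }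

Move-enum : Enumeration {Move} _≡_
Move-enum = record
  { decode        = λ { 0 → L ; 1 → R ; _ → S }
  ; encode        = λ { L → 0 ; R → 1 ; S → 2 }
  ; decode-encode = λ { L → refl ; R → refl ; S → refl } }

Kind-enum : Enumeration {Kind} _≡_
Kind-enum = record
  { decode        = λ { 0 → normal ; 1 → query ; 2 → accept ; _ → reject }
  ; encode        = λ { normal → 0 ; query → 1 ; accept → 2 ; reject → 3 }
  ; decode-encode = λ { normal → refl ; query → refl ; accept → refl ; reject → refl } }

abstract
  pair : ℕ → ℕ → ℕ
  pair a b = proj₁ (unpair-surjective _ b a refl)

  unpair-pair : ∀ a b → unpair (pair a b) ≡ (a , b)
  unpair-pair a b = proj₂ (unpair-surjective _ b a refl)

×-enum : {A B : Set} {_~_ : A → A → Set} {_≋_ : B → B → Set} → Enumeration _~_ → Enumeration _≋_ →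
  Enumeration {A × B} (λ (a , b) (a′ , b′) → (a ~ a′) × (b ≋ b′))
×-enum {_~_ = _~_} {_≋_} E F = record
  { decode        = λ n → decode E (proj₁ (unpair n)) , decode F (proj₂ (unpair n))
  ; encode        = λ (a , b) → pair (encode E a) (encode F b)
  ; decode-encode = λ (a , b) →
      subst (λ (m , n) → (decode E m ~ a) × (decode F n ≋ b)) (sym (unpair-pair (encode E a) (encode F b)))
        (decode-encode E a , decode-encode F b) }

×-enum-≡ : {A B : Set} → Enumeration {A} _≡_ → Enumeration {B} _≡_ → Enumeration {A × B} _≡_
×-enum-≡ E F = record
  { decode        = decode (×-enum E F)
  ; encode        = encode (×-enum E F)
  ; decode-encode = λ p → cong₂ _,_ (proj₁ (decode-encode (×-enum E F) p)) (proj₂ (decode-encode (×-enum E F) p)) }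

List-enum : {A : Set} → Enumeration {A} _≡_ → Enumeration {List A} _≡_
List-enum {A} E = record
  { decode        = λ n → dec (proj₁ (unpair n)) (proj₂ (unpair n))
  ; encode        = λ xs → pair (length xs) (enc xs)
  ; decode-encode = λ xs → trans (cong (λ (m , n) → dec m n) (unpair-pair (length xs) (enc xs))) (dec-enc xs) }
  where
  dec : ℕ → ℕ → List A
  dec zero    n = []
  dec (suc k) n = decode E (proj₁ (unpair n)) ∷ dec k (proj₂ (unpair n))
  enc : List A → ℕ
  enc []       = 0
  enc (x ∷ xs) = pair (encode E x) (enc xs)
  dec-enc : ∀ xs → dec (length xs) (enc xs) ≡ xs
  dec-enc []       = refl
  dec-enc (x ∷ xs) rewrite unpair-pair (encode E x) (enc xs) = cong₂ _∷_ (decode-encode E x) (dec-enc xs)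

Fin→-enum : {A : Set} {_~_ : A → A → Set} → Enumeration _~_ → ∀ n →
  Enumeration {Fin n → A} (λ f g → ∀ i → f i ~ g i)
Fin→-enum {A} {_~_} E n = record { decode = dec n ; encode = enc n ; decode-encode = dec-enc n }
  where
  dec : ∀ n → ℕ → Fin n → A
  dec (suc n) c zero    = decode E (proj₁ (unpair c))
  dec (suc n) c (suc i) = dec n (proj₂ (unpair c)) i
  enc : ∀ n → (Fin n → A) → ℕ
  enc zero    f = 0
  enc (suc n) f = pair (encode E (f zero)) (enc n (λ i → f (suc i)))
  dec-enc : ∀ n f i → dec n (enc n f) i ~ f i
  dec-enc (suc n) f zero    rewrite unpair-pair (encode E (f zero)) (enc n (λ i → f (suc i))) = decode-encode E (f zero)
  dec-enc (suc n) f (suc i) rewrite unpair-pair (encode E (f zero)) (enc n (λ i → f (suc i))) = dec-enc n (λ i → f (suc i)) i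

Finite→-enum : {A B : Set} {_~_ : A → A → Set} {n : ℕ} (to : B → Fin n) (from : Fin n → B) → (∀ b → from (to b) ≡ b) →
  Enumeration _~_ → Enumeration {B → A} (λ f g → ∀ b → f b ~ g b)
Finite→-enum {_~_ = _~_} {n} to from from-to E = record
  { decode        = λ c b → decode (Fin→-enum E n) c (to b)
  ; encode        = λ f → encode (Fin→-enum E n) (λ i → f (from i))
  ; decode-encode = λ f b → subst (λ b′ → decode (Fin→-enum E n) _ (to b) ~ f b′) (from-to b)
                              (decode-encode (Fin→-enum E n) (λ i → f (from i)) (to b)) }

Sym→-enum : {A : Set} {_~_ : A → A → Set} → Enumeration _~_ → Enumeration {Sym → A} (λ f g → ∀ x → f x ~ g x)
Sym→-enum = Finite→-enum {n = 3}
  (λ { blank → zero ; (bit false) → suc zero ; (bit true) → suc (suc zero) })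
  (λ { zero → blank ; (suc zero) → bit false ; (suc (suc zero)) → bit true })
  (λ { blank → refl ; (bit false) → refl ; (bit true) → refl })

Bool→-enum : {A : Set} {_~_ : A → A → Set} → Enumeration _~_ → Enumeration {Bool → A} (λ f g → ∀ b → f b ~ g b)
Bool→-enum = Finite→-enum {n = 2}
  (λ { false → zero ; true → suc zero }) (λ { zero → false ; (suc zero) → true }) (λ { false → refl ; true → refl })

module _ (q : ℕ) where

  State : Set
  State = Fin (suc q)

  Table : Set
  Table = State × (State → Kind) × (State → Sym → Sym → List (State × Sym × Move × Sym × Move)) × (State → Bool → State)

  abstract
    Table-enum : Enumeration {Table} (λ (s , κ , d , a) (s′ , κ′ , d′ , a′) →
      s ≡ s′ × (∀ i → κ i ≡ κ′ i) × (∀ i x y → d i x y ≡ d′ i x y) × (∀ i b → a i b ≡ a′ i b))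
    Table-enum = ×-enum (Fin-enum q)
      (×-enum (Fin→-enum Kind-enum (suc q))
      (×-enum (Fin→-enum (Sym→-enum (Sym→-enum (List-enum (×-enum-≡ (Fin-enum q)
                (×-enum-≡ Sym-enum (×-enum-≡ Move-enum (×-enum-≡ Sym-enum Move-enum))))))) (suc q))
              (Fin→-enum (Bool→-enum (Fin-enum q)) (suc q))))

  fromTable : Table → OTM
  fromTable (s , κ , d , a) = record { Q = suc q ; start = s ; kind = κ ; δ = d ; answer = a }

OTM-enum : Enumeration _≈ᴹ_
OTM-enum = record { decode = λ n → dec (unpair n) ; encode = enc ; decode-encode = dec-enc }
  where
  dec : ℕ × ℕ → OTM
  dec (q , n) = fromTable q (decode (Table-enum q) n)
  enc : OTM → ℕ
  -- Since `start` inhabits `Fin Q`, the number of states is never zero and its predecessor can be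
  -- coded.
  enc record { Q = suc q ; start = s ; kind = κ ; δ = d ; answer = a } = pair q (encode (Table-enum q) (s , κ , d , a))
  dec-enc : ∀ M → dec (unpair (enc M)) ≈ᴹ M
  dec-enc record { Q = suc q ; start = s ; kind = κ ; δ = d ; answer = a }
    rewrite unpair-pair q (encode (Table-enum q) (s , κ , d , a))
    with decode (Table-enum q) (encode (Table-enum q) (s , κ , d , a)) | decode-encode (Table-enum q) (s , κ , d , a)
  ... | _ | refl , eκ , ed , ea = pointwise eκ ed ea

-- The three questions a transducer asks about the value v of a unary counting function:
-- is the query padded enough, does v have another binary digit, and which one is it.
data Mode : Set where
  padded more digit : Mode

Mode-enum : Enumeration {Mode} _≡_
Mode-enum = record
  { decode        = λ { 0 → padded ; 1 → more ; _ → digit }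
  ; encode        = λ { padded → 0 ; more → 1 ; digit → 2 }
  ; decode-encode = λ { padded → refl ; more → refl ; digit → refl } }

Job : Set
Job = Mode × ℕ × OTM

abstract
  Job-enum : Enumeration {Job} (λ (r , k , M) (r′ , k′ , M′) → r ≡ r′ × k ≡ k′ × M ≈ᴹ M′)
  Job-enum = ×-enum Mode-enum (×-enum ℕ-enum OTM-enum)

-- The coding closure of a free set

<⇒<ᵇ≡true : ∀ {m n} → m < n → (m <ᵇ n) ≡ true
<⇒<ᵇ≡true {m} {n} m<n with m <ᵇ n | <⇒<ᵇ m<n
... | true | _ = refl

≥⇒<ᵇ≡false : ∀ {m n} → n ≤ m → (m <ᵇ n) ≡ false
≥⇒<ᵇ≡false {m} {n} n≤m with m <ᵇ n in eq
... | false = refl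
... | true  = ⊥-elim (<⇒≱ (<ᵇ⇒< m n (subst T (sym eq) tt)) n≤m)

trunc : ℕ → Oracle → Oracle
trunc m O s = if length s <ᵇ m then O s else false

AgreeBelow : ℕ → Oracle → Oracle → Set
AgreeBelow m O O′ = ∀ s → length s < m → O s ≡ O′ s

trunc-agree : ∀ m O → AgreeBelow m (trunc m O) O
trunc-agree m O s s<m rewrite <⇒<ᵇ≡true s<m = refl

trunc-cong : ∀ {m O O′} → AgreeBelow m O O′ → ∀ s → trunc m O s ≡ trunc m O′ s
trunc-cong {m} ag s with length s <ᵇ m in eq
... | true  = ag s (<ᵇ⇒< (length s) m (subst T (sym eq) tt))
... | false = refl

digitAt : ℕ → List Bool → Bool
digitAt _       []       = false
digitAt zero    (b ∷ bs) = b
digitAt (suc i) (b ∷ bs) = digitAt i bs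

jobValue : Oracle → Job → ℕ → ℕ → ℕ
jobValue O (_ , k , M) n m = accCount (trunc m O) M (poly k n) (initConfig M (unary n))

-- The oracle spares the transducer all arithmetic: `padded` tells it when m has passed the clock.
-- Digits come from the reversed numeral because the transducer prepends what it finds, while
-- numerals start with the least significant digit.
jobAnswer : Oracle → Job → ℕ → ℕ → ℕ → Bool
jobAnswer O (padded , k , _)    i n m = poly k n <ᵇ m
jobAnswer O job@(more , _ , _)  i n m = i <ᵇ length (bits (jobValue O job n m))
jobAnswer O job@(digit , _ , _) i n m = digitAt i (reverse (bits (jobValue O job n m)))

jobValue-cong : ∀ {O O′} job n {m} → AgreeBelow m O O′ → jobValue O job n m ≡ jobValue O′ job n m
jobValue-cong (_ , k , M) n ag = accCount-local M (poly k n) (initConfig M (unary n)) (λ s _ → trunc-cong ag s)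

jobAnswer-cong : ∀ {O O′} job i n {m} → AgreeBelow m O O′ → jobAnswer O job i n m ≡ jobAnswer O′ job i n m
jobAnswer-cong (padded , _ , _)     i n ag = refl
jobAnswer-cong job@(more , _ , _)   i n ag = cong (λ v → i <ᵇ length (bits v)) (jobValue-cong job n ag)
jobAnswer-cong job@(digit , _ , _)  i n ag = cong (λ v → digitAt i (reverse (bits v))) (jobValue-cong job n ag)

sameBit : Bool → Bool → Bool
sameBit true  c     = c
sameBit false true  = false
sameBit false false = true

leading : Bool → List Bool → ℕ
leading b []      = 0
leading b (c ∷ w) = if sameBit b c then suc (leading b w) else 0

dropLeading : Bool → List Bool → List Bool
dropLeading b []      = []
dropLeading b (c ∷ w) = if sameBit b c then dropLeading b w else c ∷ w

leading≤length : ∀ b w → leading b w ≤ length w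
leading≤length b []      = z≤n
leading≤length b (c ∷ w) with sameBit b c
... | true  = s≤s (leading≤length b w)
... | false = z≤n

length-dropLeading : ∀ b w → length (dropLeading b w) ≤ length w
length-dropLeading b []      = z≤n
length-dropLeading b (c ∷ w) with sameBit b c
... | true  = m≤n⇒m≤1+n (length-dropLeading b w)
... | false = ≤-refl

Runs : Set
Runs = ℕ × ℕ × ℕ × ℕ

-- Parsing is total. Any w, well formed or not, is answered through four run lengths that are at
-- most its length, and what follows the fourth run is ignored; this is what bounds the number of
-- different answers.
runs : List Bool → Runs
runs w₁ = leading true w₁ , leading false w₂ , leading true w₃ , leading false w₄
  where
  w₂ = dropLeading true w₁
  w₃ = dropLeading false w₂
  w₄ = dropLeading true w₃

runs-bounded : ∀ w → let (e , i , n , m) = runs w in e ≤ length w × i ≤ length w × n ≤ length w × m ≤ length w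
runs-bounded w₁ = leading≤length true w₁
  , ≤-trans (leading≤length false w₂) l₂
  , ≤-trans (leading≤length true w₃) l₃
  , ≤-trans (leading≤length false w₄) (≤-trans (length-dropLeading true w₃) l₃)
  where
  w₂ = dropLeading true w₁
  w₃ = dropLeading false w₂
  w₄ = dropLeading true w₃
  l₂ = length-dropLeading true w₁
  l₃ = ≤-trans (length-dropLeading false w₂) l₂

-- The two separators keep the middle runs nonempty: without them i = 0 would fuse 1^e with 1^n, and
-- n = 0 would fuse 0^i with 0^m. The calls of `pred` in `runsAnswer` take them off again.
jobQuery : ℕ → ℕ → ℕ → ℕ → List Bool
jobQuery e i n m = replicate e true ++ false ∷ replicate i false ++ true ∷ replicate n true ++ replicate m false

leading-replicate-++ : ∀ b e w → leading b w ≡ 0 → leading b (replicate e b ++ w) ≡ e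
leading-replicate-++ b     zero    w eq = eq
leading-replicate-++ true  (suc e) w eq = cong suc (leading-replicate-++ true e w eq)
leading-replicate-++ false (suc e) w eq = cong suc (leading-replicate-++ false e w eq)

dropLeading-replicate-++ : ∀ b e w → dropLeading b w ≡ w → dropLeading b (replicate e b ++ w) ≡ w
dropLeading-replicate-++ b     zero    w eq = eq
dropLeading-replicate-++ true  (suc e) w eq = dropLeading-replicate-++ true e w eq
dropLeading-replicate-++ false (suc e) w eq = dropLeading-replicate-++ false e w eq

leading-replicate-false : ∀ m → leading false (replicate m false) ≡ m
leading-replicate-false zero    = refl
leading-replicate-false (suc m) = cong suc (leading-replicate-false m)

leading-true-falses : ∀ m → leading true (replicate m false) ≡ 0
leading-true-falses zero    = refl
leading-true-falses (suc m) = refl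

dropLeading-true-falses : ∀ m → dropLeading true (replicate m false) ≡ replicate m false
dropLeading-true-falses zero    = refl
dropLeading-true-falses (suc m) = refl

runs-jobQuery : ∀ e i n m → runs (jobQuery e i n m) ≡ (e , suc i , suc n , m)
runs-jobQuery e i n m
  rewrite leading-replicate-++ true e (false ∷ replicate i false ++ true ∷ replicate n true ++ replicate m false) refl
        | dropLeading-replicate-++ true e (false ∷ replicate i false ++ true ∷ replicate n true ++ replicate m false) refl
        | leading-replicate-++ false i (true ∷ replicate n true ++ replicate m false) refl
        | dropLeading-replicate-++ false i (true ∷ replicate n true ++ replicate m false) refl
        | leading-replicate-++ true n (replicate m false) (leading-true-falses m)
        | dropLeading-replicate-++ true n (replicate m false) (dropLeading-true-falses m)
        | leading-replicate-false m
  = refl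

runsAnswer : Oracle → Runs → Bool
runsAnswer O (e , i , n , m) = jobAnswer O (decode Job-enum e) (pred i) (pred n) m

-- The cut-off m is itself a run length of w, hence at most the length of w. This is the source of
-- well-foundedness.
runsAnswer-cong : ∀ {O O′} w → AgreeBelow (length w) O O′ → runsAnswer O (runs w) ≡ runsAnswer O′ (runs w)
runsAnswer-cong w ag = jobAnswer-cong (decode Job-enum (leading true w)) (pred (proj₁ (proj₂ (runs w)))) (pred (proj₁ (proj₂ (proj₂ (runs w)))))
  (λ s s<m → ag s (≤-trans s<m (proj₂ (proj₂ (proj₂ (runs-bounded w))))))

rule : Oracle → Oracle → Oracle
rule F O []          = false
rule F O (false ∷ w) = F w
rule F O (true ∷ w)  = runsAnswer O (runs w)

-- Fuel stands in for recursion on length: `rule` consults only strings shorter than its argument,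
-- so any fuel above the length gives the same answer.
approx : Oracle → ℕ → Oracle
approx F zero    s = false
approx F (suc n) s = rule F (approx F n) s

closure : Oracle → Oracle
closure F s = approx F (suc (length s)) s

rule-cong : ∀ F {O O′} s → AgreeBelow (length s) O O′ → rule F O s ≡ rule F O′ s
rule-cong F []          ag = refl
rule-cong F (false ∷ w) ag = refl
rule-cong F (true ∷ w)  ag = runsAnswer-cong w (λ s s<w → ag s (m≤n⇒m≤1+n s<w))

approx-stable : ∀ F a b s → length s < a → length s < b → approx F a s ≡ approx F b s
approx-stable F (suc a) (suc b) s (s≤s s≤a) (s≤s s≤b) =
  rule-cong F s (λ s′ s′<s → approx-stable F a b s′ (≤-trans s′<s s≤a) (≤-trans s′<s s≤b))

closure-unfold : ∀ F s → closure F s ≡ rule F (closure F) s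
closure-unfold F s = rule-cong F s (λ s′ s′<s → approx-stable F (length s) (suc (length s′)) s′ s′<s ≤-refl)

-- The gain from below n to up to n is the leading 0: on a string of length at most n the free set
-- is asked only about a shorter one.
approx-agree : ∀ {F F′ n} → AgreeBelow n F F′ → ∀ a → AgreeUpTo n (approx F a) (approx F′ a)
approx-agree ag zero    s           s≤n = refl
approx-agree ag (suc a) []          s≤n = refl
approx-agree ag (suc a) (false ∷ w) s≤n = ag w s≤n
approx-agree ag (suc a) (true ∷ w)  s≤n =
  runsAnswer-cong w (λ s s<w → approx-agree ag a s (≤-trans (<⇒≤ s<w) (<⇒≤ s≤n)))

closure-agree : ∀ {F F′ n} → AgreeBelow n F F′ → AgreeUpTo n (closure F) (closure F′)
closure-agree ag s s≤n = approx-agree ag (suc (length s)) s s≤n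

closure-jobQuery : ∀ F e i n m → closure F (true ∷ jobQuery e i n m) ≡ jobAnswer (closure F) (decode Job-enum e) i n m
closure-jobQuery F e i n m =
  trans (closure-unfold F (true ∷ jobQuery e i n m)) (cong (runsAnswer (closure F)) (runs-jobQuery e i n m))

-- Queries made within time poly k n are shorter than m, so truncation does not affect them.
jobValue-padded : ∀ O r k M n m → poly k n < m →
  jobValue O (r , k , M) n m ≡ accCount O M (poly k n) (initConfig M (unary n))
jobValue-padded O r k M n m pad =
  accCount-local M (poly k n) (initConfig M (unary n)) (λ s s≤ → trunc-agree m O s (≤-<-trans s≤ pad))

-- The digit-reading transducer

record Finite (A : Set) : Set where
  field
    size    : ℕ
    to      : A → Fin size
    from    : Fin size → A
    from-to : ∀ a → from (to a) ≡ a

Finite-Fin : ∀ n → Finite (Fin n)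
Finite-Fin n = record { size = n ; to = λ i → i ; from = λ i → i ; from-to = λ _ → refl }

Finite-⊎ : ∀ {A B} → Finite A → Finite B → Finite (A ⊎ B)
Finite-⊎ FA FB = record
  { size    = A.size + B.size
  ; to      = λ s → join A.size B.size (Sum.map A.to B.to s)
  ; from    = λ i → Sum.map A.from B.from (splitAt A.size i)
  ; from-to = λ s → trans (cong (Sum.map A.from B.from) (splitAt-join A.size B.size (Sum.map A.to B.to s))) (roundtrip s) }
  where
  module A = Finite FA
  module B = Finite FB
  roundtrip : ∀ s → Sum.map A.from B.from (Sum.map A.to B.to s) ≡ s
  roundtrip (inj₁ a) = cong inj₁ (A.from-to a)
  roundtrip (inj₂ b) = cong inj₂ (B.from-to b)

Finite-× : ∀ {A B} → Finite A → Finite B → Finite (A × B)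
Finite-× FA FB = record
  { size    = A.size * B.size
  ; to      = λ (a , b) → combine (A.to a) (B.to b)
  ; from    = λ i → Product.map A.from B.from (remQuot B.size i)
  ; from-to = λ (a , b) → trans (cong (Product.map A.from B.from) (remQuot-combine (A.to a) (B.to b)))
                            (cong₂ _,_ (A.from-to a) (B.from-to b)) }
  where
  module A = Finite FA
  module B = Finite FB

Finite-retract : ∀ {A B} → Finite A → (f : B → A) (g : A → B) → (∀ b → g (f b) ≡ b) → Finite B
Finite-retract FA f g gf = record
  { size    = size
  ; to      = λ b → to (f b)
  ; from    = λ i → g (from i)
  ; from-to = λ b → trans (cong g (from-to (f b))) (gf b) }
  where open Finite FA

-- Deterministic machines and their running time

module DeterministicMachine {St : Set} (fin : Finite St) (st₀ : St) (κ : St → Kind)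
       (tr : St → Sym → St × Sym × Move × Sym × Move) (ans : St → Bool → St) where

  open Finite fin

  relabel : St × Sym × Move × Sym × Move → Fin size × Sym × Move × Sym × Move
  relabel (st , act) = to st , act

  machine : OTM
  machine = record
    { Q      = size
    ; start  = to st₀
    ; kind   = λ i → κ (from i)
    ; δ      = λ i x _ → relabel (tr (from i) x) ∷ []
    ; answer = λ i b → to (ans (from i) b) }

  deterministic : IsDeterministic machine
  deterministic _ _ _ = s≤s z≤n

  record Snapshot : Set where
    constructor at
    field
      phaseOf  : St
      workOf   : Tape
      oracleOf : Tape

  snapshotConfig : Snapshot → Config machine
  snapshotConfig (at st w o) = config (to st) w o

  module Execution (D : Oracle) (X : ℕ) where

    record Steps (t : ℕ) (c c′ : Snapshot) : Set where
      constructor mkSteps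
      field
        run-steps : ∀ s → run D machine (t + s) (snapshotConfig c) ≡ run D machine s (snapshotConfig c′)
    open Steps public

    idle : ∀ {c} → Steps 0 c c
    idle = mkSteps (λ _ → refl)

    infixr 5 _⨟_
    _⨟_ : ∀ {t t′ c₁ c₂ c₃} → Steps t c₁ c₂ → Steps t′ c₂ c₃ → Steps (t + t′) c₁ c₃
    _⨟_ {t} {t′} {c₁} p q = mkSteps λ s →
      trans (cong (λ u → run D machine u (snapshotConfig c₁)) (+-assoc t t′ s)) (trans (run-steps p (t′ + s)) (run-steps q s))

    cast-time : ∀ {t t′ c c′} → t ≡ t′ → Steps t c c′ → Steps t′ c c′
    cast-time refl p = p

    cast-end : ∀ {t c c′ c″} → c′ ≡ c″ → Steps t c c′ → Steps t c c″
    cast-end refl p = p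

    -- Time is measured in phases of at most X steps each.
    record Reach (k : ℕ) (c c′ : Snapshot) : Set where
      constructor mkReach
      field
        {time}     : ℕ
        time-bound : time ≤ k * X
        reach      : Steps time c c′
    open Reach public

    infixr 5 _⨾_
    _⨾_ : ∀ {j k c₁ c₂ c₃} → Reach j c₁ c₂ → Reach k c₂ c₃ → Reach (j + k) c₁ c₃
    _⨾_ {j} {k} (mkReach t≤ p) (mkReach t′≤ q) =
      mkReach (≤-trans (+-mono-≤ t≤ t′≤) (≤-reflexive (sym (*-distribʳ-+ X j k)))) (p ⨟ q)

    relax : ∀ {j k c c′} → j ≤ k → Reach j c c′ → Reach k c c′
    relax j≤k (mkReach t≤ p) = mkReach (≤-trans t≤ (*-monoˡ-≤ X j≤k)) p

    phase : ∀ {t c c′} → t ≤ X → Steps t c c′ → Reach 1 c c′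
    phase t≤X = mkReach (≤-trans t≤X (≤-reflexive (sym (*-identityˡ X))))

    normal-step : ∀ {st w o st′ w′ o′ sw mw so mo} → κ st ≡ normal → tr st (here w) ≡ (st′ , sw , mw , so , mo) →
      writeMove sw mw w ≡ w′ → writeMove so mo o ≡ o′ → Steps 1 (at st w o) (at st′ w′ o′)
    normal-step {st} {w} {o} isNormal eq refl refl .run-steps s rewrite trans (cong κ (from-to st)) isNormal =
      cong (λ act → run D machine s (applyTr (config (to st) w o) (relabel act))) (trans (cong (λ st → tr st (here w)) (from-to st)) eq)

    query-step : ∀ {st w o} → κ st ≡ query → Steps 1 (at st w o) (at (ans st (D (tapeBits o))) w blankTape)
    query-step {st} {w} {o} isQuery .run-steps s rewrite trans (cong κ (from-to st)) isQuery =
      cong (λ st → run D machine s (config (to (ans st (D (tapeBits o)))) w blankTape)) (from-to st)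

    accept-halts : ∀ {st w o} → κ st ≡ accept → ∀ s → run D machine s (config (to st) w o) ≡ just (config (to st) w o)
    accept-halts {st} isAccept s rewrite from-to st | isAccept = refl

    run-accepting : ∀ {k c st w o t} → Reach k c (at st w o) → κ st ≡ accept → k * X ≤ t →
      run D machine t (snapshotConfig c) ≡ just (config (to st) w o)
    run-accepting {c = c} p isAccept bound with m≤n⇒∃[o]m+o≡n (≤-trans (time-bound p) bound)
    ... | s , eq = trans (cong (λ t → run D machine t (snapshotConfig c)) (sym eq)) (trans (run-steps (reach p) s) (accept-halts isAccept s))

popL : List Sym → List Sym → Tape
popL []      r = tape [] blank r
popL (x ∷ l) r = tape l x r

popR : List Sym → List Sym → Tape
popR l []      = tape l blank []
popR l (x ∷ r) = tape l x r

writeMove-L : ∀ s l h r → writeMove s L (tape l h r) ≡ popL l (s ∷ r)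
writeMove-L s []      h r = refl
writeMove-L s (x ∷ l) h r = refl

writeMove-R : ∀ s l h r → writeMove s R (tape l h r) ≡ popR (s ∷ l) r
writeMove-R s l h []      = refl
writeMove-R s l h (x ∷ r) = refl

inputTape-popR : ∀ x → inputTape x ≡ popR [] (toSyms x)
inputTape-popR []      = refl
inputTape-popR (b ∷ x) = refl

symsBits-toSyms : ∀ x → symsBits (toSyms x) ≡ x
symsBits-toSyms []      = refl
symsBits-toSyms (b ∷ x) = cong (b ∷_) (symsBits-toSyms x)

-- Queries are written from right to left. The head rests on the blank before the word, so writing a
-- bit and moving left is, by computation, prepending it.
queryTape : List Bool → Tape
queryTape q = tape [] blank (toSyms q)

-- The job code is hard-wired: `signing` counts it down in the state, where N bounds the codes in
-- use.
data Phase (N : ℕ) : Set where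
  toEnd toSeparator copyWord copyOutput asking done : Phase N
  signing  : Fin (suc N) → Phase N
  answered : Bool → Phase N

Finite-Phase : ∀ N → Finite (Phase N)
Finite-Phase N = Finite-retract (Finite-⊎ (Finite-Fin 8) (Finite-Fin (suc N))) f g gf
  where
  f : Phase N → Fin 8 ⊎ Fin (suc N)
  f toEnd            = inj₁ zero
  f toSeparator      = inj₁ (suc zero)
  f copyWord         = inj₁ (suc (suc zero))
  f copyOutput       = inj₁ (suc (suc (suc zero)))
  f asking           = inj₁ (suc (suc (suc (suc zero))))
  f done             = inj₁ (suc (suc (suc (suc (suc zero)))))
  f (answered false) = inj₁ (suc (suc (suc (suc (suc (suc zero))))))
  f (answered true)  = inj₁ (suc (suc (suc (suc (suc (suc (suc zero)))))))
  f (signing j)      = inj₂ j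
  g : Fin 8 ⊎ Fin (suc N) → Phase N
  g (inj₁ zero)                                            = toEnd
  g (inj₁ (suc zero))                                      = toSeparator
  g (inj₁ (suc (suc zero)))                                = copyWord
  g (inj₁ (suc (suc (suc zero))))                          = copyOutput
  g (inj₁ (suc (suc (suc (suc zero)))))                    = asking
  g (inj₁ (suc (suc (suc (suc (suc zero))))))              = done
  g (inj₁ (suc (suc (suc (suc (suc (suc zero)))))))        = answered false
  g (inj₁ (suc (suc (suc (suc (suc (suc (suc zero)))))))) = answered true
  g (inj₂ j)                                               = signing j
  gf : ∀ p → g (f p) ≡ p
  gf toEnd            = refl
  gf toSeparator      = refl
  gf copyWord         = refl
  gf copyOutput       = refl
  gf asking           = refl
  gf done             = refl
  gf (answered false) = refl
  gf (answered true)  = refl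
  gf (signing j)      = refl

Finite-Mode : Finite Mode
Finite-Mode = Finite-retract (Finite-Fin 3)
  (λ { padded → zero ; more → suc zero ; digit → suc (suc zero) })
  (λ { zero → padded ; (suc zero) → more ; (suc (suc zero)) → digit })
  (λ { padded → refl ; more → refl ; digit → refl })

-- The work tape holds  out _ 1ⁿ 0ᵐ , where out is the part of the output found so far (most significant
-- digits first, so it grows to the left).  Each round appends a 0 at the right end, copies the tape
-- leftwards as the query 1^(e+1) 0^(|out|+1) 1^(n+1) 0ᵐ and evaluates the answer at the left end.
module Transducer (N : ℕ) (code : Mode → ℕ) where

  TState : Set
  TState = Mode × Phase N

  kindOf : TState → Kind
  kindOf (_ , asking) = query
  kindOf (_ , done)   = accept
  kindOf _            = normal

  transition : TState → Sym → TState × Sym × Move × Sym × Move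
  transition (r , toEnd)           (bit b) = (r , toEnd)                          , bit b     , R , blank     , S
  transition (r , toEnd)           blank   = (r , copyWord)                       , bit false , S , blank     , S
  transition (r , copyWord)        (bit b) = (r , copyWord)                       , bit b     , L , bit b     , L
  transition (r , copyWord)        blank   = (r , copyOutput)                     , blank     , L , bit true  , L
  transition (r , copyOutput)      (bit b) = (r , copyOutput)                     , bit b     , L , bit false , L
  transition (r , copyOutput)      blank   = (r , signing (clamp N (code r)))     , blank     , S , bit false , L
  transition (r , signing zero)    x       = (r , asking)                         , x         , S , bit true  , L
  transition (r , signing (suc j)) x       = (r , signing (inject₁ j))            , x         , S , bit true  , L
  transition (padded , answered false) _   = (padded , toSeparator)               , blank     , R , blank     , S
  transition (padded , answered true)  _   = (more , toSeparator)                 , blank     , R , blank     , S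
  transition (more   , answered true)  _   = (digit , toSeparator)                , blank     , R , blank     , S
  transition (more   , answered false) _   = (more , done)                        , blank     , R , blank     , S
  -- The new digit needs a fresh blank to its left; (padded , answered true) then just starts the next round.
  transition (digit  , answered b)     _   = (padded , answered true)             , bit b     , L , blank     , S
  transition (r , toSeparator)     (bit b) = (r , toSeparator)                    , bit b     , R , blank     , S
  transition (r , toSeparator)     blank   = (r , toEnd)                          , blank     , R , blank     , S
  -- Junk values: asking and done are not normal states.
  transition (r , asking)          x       = (r , done)                           , x         , S , blank     , S
  transition (r , done)            x       = (r , done)                           , x         , S , blank     , S

  evaluate : TState → Bool → TState
  evaluate (r , _) b = r , answered b

  open DeterministicMachine (Finite-× Finite-Mode (Finite-Phase N)) (padded , toEnd) kindOf transition evaluate public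

  module Rounds (D : Oracle) (X : ℕ) where

    open Execution D X public

    scan-toEnd : ∀ r l x → Steps (length x)
      (at (r , toEnd) (popR l (toSyms x)) blankTape) (at (r , toEnd) (tape (toSyms x ʳ++ l) blank []) blankTape)
    scan-toEnd r l []      = idle
    scan-toEnd r l (b ∷ x) =
      normal-step refl refl (writeMove-R (bit b) l (bit b) (toSyms x)) refl
      ⨟ scan-toEnd r (bit b ∷ l) x

    scan-toSeparator : ∀ r l x rest → Steps (length x)
      (at (r , toSeparator) (popR l (toSyms x ++ blank ∷ rest)) blankTape)
      (at (r , toSeparator) (tape (toSyms x ʳ++ l) blank rest) blankTape)
    scan-toSeparator r l []      rest = idle
    scan-toSeparator r l (b ∷ x) rest =
      normal-step refl refl (writeMove-R (bit b) l (bit b) (toSyms x ++ blank ∷ rest)) refl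
      ⨟ scan-toSeparator r (bit b ∷ l) x rest

    scan-copyWord : ∀ r l x rest q → Steps (length x)
      (at (r , copyWord) (popL (toSyms x ʳ++ l) rest) (queryTape q))
      (at (r , copyWord) (popL l (toSyms x ++ rest)) (queryTape (x ++ q)))
    scan-copyWord r l []      rest q = idle
    scan-copyWord r l (b ∷ x) rest q = cast-time (+-comm (length x) 1)
      (scan-copyWord r (bit b ∷ l) x rest q
      ⨟ normal-step refl refl (writeMove-L (bit b) l (bit b) (toSyms x ++ rest)) refl)

    scan-copyOutput : ∀ r l x rest q → Steps (length x)
      (at (r , copyOutput) (popL (toSyms x ʳ++ l) rest) (queryTape q))
      (at (r , copyOutput) (popL l (toSyms x ++ rest)) (queryTape (replicate (length x) false ++ q)))
    scan-copyOutput r l []      rest q = idle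
    scan-copyOutput r l (b ∷ x) rest q = cast-time (+-comm (length x) 1)
      (scan-copyOutput r (bit b ∷ l) x rest q
      ⨟ normal-step refl refl (writeMove-L (bit b) l (bit b) (toSyms x ++ rest)) refl)

    -- Counting down from n to zero writes n+1 ones: n for the code and one for the flag that marks
    -- the query as a coded one.
    sign : ∀ r w n j → toℕ j ≡ n → ∀ q → Steps (suc n)
      (at (r , signing j) w (queryTape q)) (at (r , asking) w (queryTape (true ∷ replicate n true ++ q)))
    sign r w _ zero    refl q = normal-step refl refl refl refl
    sign r w _ (suc j) refl q =
      normal-step refl refl refl refl
      ⨟ cast-end (cong (λ q′ → at (r , asking) w (queryTape (true ∷ q′))) (replicate-∷ (toℕ j)))
          (sign r w (toℕ j) (inject₁ j) (toℕ-inject₁ j) (true ∷ q))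
      where
      replicate-∷ : ∀ n → replicate n true ++ true ∷ q ≡ true ∷ replicate n true ++ q
      replicate-∷ zero    = refl
      replicate-∷ (suc n) = cong (true ∷_) (replicate-∷ n)

    -- What lies to the left of the word, nearest cell first. At the start nothing has been visited
    -- there; later the list holds the separator, the output and the blank at the left end.
    data LeftPart : List Bool → List Sym → Set where
      fresh  : LeftPart [] []
      marked : ∀ {out} → LeftPart out (blank ∷ (toSyms out ʳ++ blank ∷ []))

    word : ℕ → ℕ → List Bool
    word n m = replicate n true ++ replicate m false

    atRight : Mode → List Sym → ℕ → ℕ → Snapshot
    atRight r left n m = at (r , toEnd) (tape (toSyms (word n m) ʳ++ left) blank []) blankTape

    atLeft : Mode → Bool → List Bool → ℕ → ℕ → Snapshot
    atLeft r b out n m = at (r , answered b) (tape [] blank (toSyms out ++ blank ∷ toSyms (word n m))) blankTape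

    word-∷ʳ : ∀ n m → word n m ++ false ∷ [] ≡ word n (suc m)
    word-∷ʳ zero    zero    = refl
    word-∷ʳ zero    (suc m) = cong (false ∷_) (word-∷ʳ zero m)
    word-∷ʳ (suc n) m       = cong (true ∷_) (word-∷ʳ n m)

    length-word : ∀ n m → length (word n m) ≡ n + m
    length-word n m = trans (length-++ (replicate n true)) (cong₂ _+_ (length-replicate n) (length-replicate m))

    tapeBits-queryTape : ∀ q → tapeBits (queryTape q) ≡ q
    tapeBits-queryTape = symsBits-toSyms

    padded-word : ∀ left x → popL (toSyms (x ++ false ∷ []) ʳ++ left) [] ≡ tape (toSyms x ʳ++ left) (bit false) []
    padded-word left []      = refl
    padded-word left (b ∷ x) = padded-word (bit b ∷ left) x

    -- The seven phases: append a 0, copy the word, cross the separator, copy the output, start the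
    -- signature, finish it, query.
    ask : ∀ r {out left} n m → LeftPart out left → code r ≤ N → suc (n + suc m + length out + code r) ≤ X →
      Reach 7 (atRight r left n m) (atLeft r (D (true ∷ jobQuery (code r) (length out) n (suc m))) out n (suc m))
    ask r {out} {left} n m lp code≤N bound =
      phase one (normal-step refl refl (sym pad) refl)
      ⨾ phase (subst (_≤ X) (sym (length-word n (suc m))) word≤X) scanned
      ⨾ copy lp out≤X
      ⨾ phase one (normal-step refl refl refl refl)
      ⨾ phase code≤X (sign r _ (code r) (clamp N (code r)) (toℕ-clamp code≤N) _)
      ⨾ phase one asked
      where
      w′ = word n (suc m)
      q  = true ∷ jobQuery (code r) (length out) n (suc m)
      one : 1 ≤ X
      one = ≤-trans (s≤s z≤n) bound
      word≤X : n + suc m ≤ X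
      word≤X = ≤-trans (≤-trans (m≤m+n _ (length out)) (m≤m+n _ (code r))) (<⇒≤ bound)
      out≤X : length out ≤ X
      out≤X = ≤-trans (≤-trans (m≤n+m _ (n + suc m)) (m≤m+n _ (code r))) (<⇒≤ bound)
      code≤X : suc (code r) ≤ X
      code≤X = ≤-trans (s≤s (m≤n+m _ _)) bound
      pad : popL (toSyms w′ ʳ++ left) [] ≡ tape (toSyms (word n m) ʳ++ left) (bit false) []
      pad = trans (cong (λ x → popL (toSyms x ʳ++ left) []) (sym (word-∷ʳ n m))) (padded-word left (word n m))
      scanned : Steps (length w′) (at (r , copyWord) (popL (toSyms w′ ʳ++ left) []) (queryTape []))
                                  (at (r , copyWord) (popL left (toSyms w′)) (queryTape w′))
      scanned = cast-end (cong₂ (λ u v → at (r , copyWord) (popL left u) (queryTape v))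
        (++-identityʳ (toSyms w′)) (++-identityʳ w′)) (scan-copyWord r left w′ [] [])
      copy : ∀ {out left} → LeftPart out left → length out ≤ X →
        Reach 2 (at (r , copyWord) (popL left (toSyms w′)) (queryTape w′))
                (at (r , copyOutput) (tape [] blank (toSyms out ++ blank ∷ toSyms w′))
                                     (queryTape (replicate (length out) false ++ true ∷ w′)))
      -- With no output yet, an idle phase evens out the count with the other case.
      copy fresh          _     = phase one (normal-step refl refl refl refl) ⨾ phase z≤n idle
      copy (marked {out}) out≤X =
        phase one (normal-step refl refl (writeMove-L blank (toSyms out ʳ++ blank ∷ []) blank _) refl)
        ⨾ phase out≤X (scan-copyOutput r (blank ∷ []) out (blank ∷ toSyms w′) (true ∷ w′))
      asked : Steps 1 (at (r , asking) (tape [] blank (toSyms out ++ blank ∷ toSyms w′)) (queryTape q)) (atLeft r (D q) out n (suc m))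
      asked = cast-end (cong (λ q′ → atLeft r (D q′) out n (suc m)) (tapeBits-queryTape q)) (query-step refl)

    goRight : ∀ r {st} out n m → transition st blank ≡ ((r , toSeparator) , blank , R , blank , S) → kindOf st ≡ normal →
      suc (n + m + length out) ≤ X →
      Reach 4 (at st (tape [] blank (toSyms out ++ blank ∷ toSyms (word n m))) blankTape)
              (atRight r (blank ∷ (toSyms out ʳ++ blank ∷ [])) n m)
    goRight r out n m eq isNormal bound =
      phase one (normal-step isNormal eq (writeMove-R blank [] blank (toSyms out ++ blank ∷ toSyms (word n m))) refl)
      ⨾ phase out≤X (scan-toSeparator r (blank ∷ []) out (toSyms (word n m)))
      ⨾ phase one (normal-step refl refl (writeMove-R blank (toSyms out ʳ++ blank ∷ []) blank (toSyms (word n m))) refl)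
      ⨾ phase (subst (_≤ X) (sym (length-word n m)) word≤X) (scan-toEnd r (blank ∷ (toSyms out ʳ++ blank ∷ [])) (word n m))
      where
      one : 1 ≤ X
      one = ≤-trans (s≤s z≤n) bound
      word≤X : n + m ≤ X
      word≤X = ≤-trans (m≤m+n _ (length out)) (<⇒≤ bound)
      out≤X : length out ≤ X
      out≤X = ≤-trans (m≤n+m _ (n + m)) (<⇒≤ bound)

-- Correctness and running time of the transducer

digitAt-++ : ∀ xs d ys → digitAt (length xs) (xs ++ d ∷ ys) ≡ d
digitAt-++ []       d ys = refl
digitAt-++ (x ∷ xs) d ys = digitAt-++ xs d ys

-- The blank separator ends the output, so the input and the padding behind it may stay on the tape.
readOut-popR : ∀ l x rest → readOut (here (popR l (toSyms x ++ blank ∷ rest))) (right (popR l (toSyms x ++ blank ∷ rest))) ≡ x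
readOut-popR l []          rest = refl
readOut-popR l (b ∷ [])    rest = refl
readOut-popR l (b ∷ c ∷ x) rest = cong (b ∷_) (readOut-popR l (c ∷ x) rest)

module Computation (N : ℕ) (code : Mode → ℕ) (code≤N : ∀ r → code r ≤ N) (D : Oracle) (n t₀ : ℕ) (V : List Bool)
  (ans-padded : ∀ i m → D (true ∷ jobQuery (code padded) i n m) ≡ (t₀ <ᵇ m))
  (ans-more   : ∀ i m → t₀ < m → D (true ∷ jobQuery (code more) i n m) ≡ (i <ᵇ length V))
  (ans-digit  : ∀ i m → t₀ < m → D (true ∷ jobQuery (code digit) i n m) ≡ digitAt i (reverse V))
  (X : ℕ) (enough : suc (n + suc (suc (t₀ + length V * 2)) + length V + N) ≤ X) where

  open Transducer N code
  open Rounds D X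

  -- Every round lengthens the padding by one: t₀+1 rounds to pass the clock, two for each digit,
  -- and a last one that finds no further digit.
  mmax : ℕ
  mmax = suc (suc (t₀ + length V * 2))

  round-bound : ∀ r {m ℓ} → m ≤ mmax → ℓ ≤ length V → suc (n + m + ℓ + code r) ≤ X
  round-bound r m≤ ℓ≤ = ≤-trans (s≤s (+-mono-≤ (+-mono-≤ (+-monoʳ-≤ n m≤) ℓ≤) (code≤N r))) enough

  right-bound : ∀ {m ℓ} → m ≤ mmax → ℓ ≤ length V → suc (n + m + ℓ) ≤ X
  right-bound m≤ ℓ≤ = ≤-trans (s≤s (m≤m+n _ (code padded))) (round-bound padded m≤ ℓ≤)

  ask′ : ∀ r {out left b} m → LeftPart out left → suc m ≤ mmax → length out ≤ length V →
    D (true ∷ jobQuery (code r) (length out) n (suc m)) ≡ b → Reach 7 (atRight r left n m) (atLeft r b out n (suc m))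
  ask′ r m lp m≤ out≤ refl = ask r n m lp (code≤N r) (round-bound r m≤ out≤)

  marked-left : List Bool → List Sym
  marked-left out = blank ∷ (toSyms out ʳ++ blank ∷ [])

  -- Here d is the number of unsuccessful rounds still to come. A round takes 11 phases, 7 for `ask`
  -- and 4 for `goRight`.
  pad-up : ∀ d m {left} → LeftPart [] left → m + d ≡ t₀ →
    Reach (suc d * 11) (atRight padded left n m) (atRight more (marked-left []) n (suc t₀))
  pad-up zero m lp eq with trans (sym (+-identityʳ m)) eq
  ... | refl = ask′ padded m lp m≤ z≤n (trans (ans-padded 0 (suc m)) (<⇒<ᵇ≡true (n<1+n m)))
             ⨾ goRight more [] n (suc m) refl refl (right-bound m≤ z≤n)
    where
    m≤ : suc m ≤ mmax
    m≤ = s≤s (m≤n⇒m≤1+n (m≤m+n m _))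
  pad-up (suc d) m lp eq =
    ask′ padded m lp m≤ z≤n (trans (ans-padded 0 (suc m)) (≥⇒<ᵇ≡false 1+m≤t₀))
    ⨾ goRight padded [] n (suc m) refl refl (right-bound m≤ z≤n)
    ⨾ pad-up d (suc m) marked (trans (sym (+-suc m d)) eq)
    where
    1+m≤t₀ : suc m ≤ t₀
    1+m≤t₀ = ≤-trans (m≤m+n (suc m) d) (≤-reflexive (trans (sym (+-suc m d)) eq))
    m≤ : suc m ≤ mmax
    m≤ = ≤-trans 1+m≤t₀ (m≤n⇒m≤1+n (m≤n⇒m≤1+n (m≤m+n t₀ _)))

  final : ℕ → Snapshot
  final m = at (more , done) (popR (blank ∷ []) (toSyms V ++ blank ∷ toSyms (word n m))) blankTape

  length-split : ∀ out ds → reverse V ≡ reverse out ++ ds → length V ≡ length out + length ds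
  length-split out ds eq = begin
    length V                           ≡⟨ sym (length-reverse V) ⟩
    length (reverse V)                 ≡⟨ cong length eq ⟩
    length (reverse out ++ ds)         ≡⟨ length-++ (reverse out) ⟩
    length (reverse out) + length ds   ≡⟨ cong (_+ length ds) (length-reverse out) ⟩
    length out + length ds             ∎
    where open ≡-Reasoning

  -- The list ds holds the missing digits, most significant first. A digit costs 23 phases: two
  -- calls of `ask` (7 each), two of `goRight` (4 each) and the step that writes it. The final 8 are
  -- one `ask` and the step onto the first output cell.
  emit : ∀ ds out m → reverse V ≡ reverse out ++ ds → t₀ < m → suc (m + length ds * 2) ≤ mmax →
    Σ ℕ λ m′ → Reach (length ds * 23 + 8) (atRight more (marked-left out) n m) (final m′)
  emit [] out m eq t₀<m m≤ with reverse-injective {x = V} {y = out} (trans eq (++-identityʳ (reverse out)))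
  ... | refl = suc m ,
    (ask′ more m marked m≤′ ≤-refl (trans (ans-more (length V) (suc m) (m≤n⇒m≤1+n t₀<m)) (≥⇒<ᵇ≡false (≤-refl {length V})))
    ⨾ phase (≤-trans (s≤s z≤n) (right-bound m≤′ (≤-refl {length V})))
        (normal-step refl refl (writeMove-R blank [] blank (toSyms V ++ blank ∷ toSyms (word n (suc m)))) refl))
    where
    m≤′ : suc m ≤ mmax
    m≤′ = ≤-trans (s≤s (m≤m+n m 0)) m≤
  emit (d ∷ ds) out m eq t₀<m m≤ with emit ds (d ∷ out) (suc (suc m)) eq′ (m≤n⇒m≤1+n (m≤n⇒m≤1+n t₀<m)) m≤′
    where
    eq′ : reverse V ≡ reverse (d ∷ out) ++ ds
    eq′ = trans eq (trans (sym (++-assoc (reverse out) (d ∷ []) ds)) (cong (_++ ds) (sym (unfold-reverse d out))))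
    m≤′ : suc (suc (suc m) + length ds * 2) ≤ mmax
    m≤′ = ≤-trans (≤-reflexive (cong suc (trans (cong suc (sym (+-suc m (length ds * 2)))) (sym (+-suc m (suc (length ds * 2))))))) m≤
  ... | m′ , rest = m′ ,
    (ask′ more m marked m₁ out≤ (trans (ans-more (length out) (suc m) (m≤n⇒m≤1+n t₀<m)) (<⇒<ᵇ≡true out<))
    ⨾ goRight digit out n (suc m) refl refl (right-bound m₁ out≤)
    ⨾ ask′ digit (suc m) marked m₂ out≤ (trans (ans-digit (length out) (suc (suc m)) (m≤n⇒m≤1+n (m≤n⇒m≤1+n t₀<m))) isDigit)
    ⨾ phase (≤-trans (s≤s z≤n) (right-bound m₂ out<)) (normal-step refl refl refl refl)
    ⨾ goRight more (d ∷ out) n (suc (suc m)) refl refl (right-bound m₂ out<)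
    ⨾ rest)
    where
    out< : length out < length V
    out< = ≤-trans (m≤m+n (suc (length out)) (length ds))
      (≤-reflexive (trans (sym (+-suc (length out) (length ds))) (sym (length-split out (d ∷ ds) eq))))
    out≤ : length out ≤ length V
    out≤ = <⇒≤ out<
    m₂ : suc (suc m) ≤ mmax
    m₂ = ≤-trans (s≤s (≤-trans (≤-reflexive (sym (+-comm m 1))) (+-monoʳ-≤ m (s≤s z≤n)))) m≤
    m₁ : suc m ≤ mmax
    m₁ = <⇒≤ m₂
    isDigit : digitAt (length out) (reverse V) ≡ d
    isDigit = trans (cong₂ digitAt (sym (length-reverse out)) eq) (digitAt-++ (reverse out) d ds)

  initially : Reach 1 (at (padded , toEnd) (popR [] (toSyms (unary n))) blankTape) (atRight padded [] n 0)
  initially = phase (≤-trans (≤-reflexive (length-replicate n)) n≤X)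
    (cast-end (cong (λ x → at (padded , toEnd) (tape (toSyms x ʳ++ []) blank []) blankTape) (sym (++-identityʳ (unary n))))
      (scan-toEnd padded [] (unary n)))
    where
    n≤X : n ≤ X
    n≤X = ≤-trans (≤-trans (m≤m+n n 0) (m≤m+n (n + 0) 0)) (<⇒≤ (right-bound z≤n z≤n))

  phases : ℕ
  phases = 1 + (suc t₀ * 11 + (length V * 23 + 8))

  whole : Σ ℕ λ m → Reach phases (at (padded , toEnd) (popR [] (toSyms (unary n))) blankTape) (final m)
  whole with emit (reverse V) [] (suc t₀) refl ≤-refl
    (≤-reflexive (cong (λ ℓ → suc (suc (t₀ + ℓ * 2))) (length-reverse V)))
  ... | m , emitted = m , initially ⨾ pad-up t₀ 0 fresh refl
                        ⨾ relax (≤-reflexive (cong (λ ℓ → ℓ * 23 + 8) (length-reverse V))) emitted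

  computes : ∀ t → phases * X ≤ t → Maybe.map output (run D machine t (initConfig machine (unary n))) ≡ just V
  computes t bound = begin
    Maybe.map output (run D machine t (initConfig machine (unary n)))
      ≡⟨ cong (λ w → Maybe.map output (run D machine t (config (start machine) w blankTape))) (inputTape-popR (unary n)) ⟩
    Maybe.map output (run D machine t (config (start machine) (popR [] (toSyms (unary n))) blankTape))
      ≡⟨ cong (Maybe.map output) (run-accepting (proj₂ whole) refl bound) ⟩
    just (readOut (here w) (right w))
      ≡⟨ cong just (readOut-popR (blank ∷ []) V (toSyms (word n (proj₁ whole)))) ⟩
    just V ∎
    where
    open ≡-Reasoning
    w = popR (blank ∷ []) (toSyms V ++ blank ∷ toSyms (word n (proj₁ whole)))

-- This inclusion holds for every free set, so F remains entirely at the disposal of the hardness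
-- argument.
SharpP₁⊆FPUnary : ∀ F f → SharpP₁ (closure F) f → FPUnary (closure F) f
SharpP₁⊆FPUnary F f (M , k , counts) =
  Transducer.machine N code , Transducer.deterministic N code , proj₁ polyTime , λ n →
    Computation.computes N code code≤N D n (poly k n) (bits (f n)) (ans-padded n) (ans-more n) (ans-digit n)
      (X n) (enough n) (poly (proj₁ polyTime) n) (≤-trans (*-monoˡ-≤ (X n) (phases≤ n)) (proj₂ polyTime n))
  where
  D = closure F

  code : Mode → ℕ
  code r = encode Job-enum (r , k , M)

  N : ℕ
  N = code padded + (code more + code digit)

  code≤N : ∀ r → code r ≤ N
  code≤N padded = m≤m+n _ _
  code≤N more   = ≤-trans (m≤m+n _ (code digit)) (m≤n+m _ (code padded))
  code≤N digit  = ≤-trans (m≤n+m _ (code more)) (m≤n+m _ (code padded))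

  ans-padded : ∀ n i m → D (true ∷ jobQuery (code padded) i n m) ≡ (poly k n <ᵇ m)
  ans-padded n i m = trans (closure-jobQuery F (code padded) i n m) answer-is
    where
    answer-is : jobAnswer D (decode Job-enum (code padded)) i n m ≡ (poly k n <ᵇ m)
    answer-is with decode Job-enum (code padded) | decode-encode Job-enum (padded , k , M)
    ... | _ | refl , refl , _ = refl

  value : ∀ r n m {M′} → M′ ≈ᴹ M → poly k n < m → jobValue D (r , k , M′) n m ≡ f n
  value r n m {M′} M′≈M pad = trans (jobValue-padded D r k M′ n m pad)
    (trans (accCount-≈ D M′≈M (poly k n) (unary n)) (proj₂ (counts n)))

  ans-more : ∀ n i m → poly k n < m → D (true ∷ jobQuery (code more) i n m) ≡ (i <ᵇ length (bits (f n)))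
  ans-more n i m pad = trans (closure-jobQuery F (code more) i n m) answer-is
    where
    answer-is : jobAnswer D (decode Job-enum (code more)) i n m ≡ (i <ᵇ length (bits (f n)))
    answer-is with decode Job-enum (code more) | decode-encode Job-enum (more , k , M)
    ... | _ | refl , refl , M′≈M = cong (λ v → i <ᵇ length (bits v)) (value more n m M′≈M pad)

  ans-digit : ∀ n i m → poly k n < m → D (true ∷ jobQuery (code digit) i n m) ≡ digitAt i (reverse (bits (f n)))
  ans-digit n i m pad = trans (closure-jobQuery F (code digit) i n m) answer-is
    where
    answer-is : jobAnswer D (decode Job-enum (code digit)) i n m ≡ digitAt i (reverse (bits (f n)))
    answer-is with decode Job-enum (code digit) | decode-encode Job-enum (digit , k , M)
    ... | _ | refl , refl , M′≈M = cong (λ v → digitAt i (reverse (bits v))) (value digit n m M′≈M pad)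

  b : ℕ
  b = proj₁ (finite-branching M)

  ℓ : ℕ → ℕ
  ℓ n = suc (suc b * poly k n)

  -- The running time depends on the number of digits to be read. There are at most exponentially
  -- many accepting paths, hence polynomially many digits.
  length≤ℓ : ∀ n → length (bits (f n)) ≤ ℓ n
  length≤ℓ n = subst (λ v → length (bits v) ≤ ℓ n) (proj₂ (counts n))
    (length-bits-accCount D M (proj₂ (finite-branching M)) (poly k n) (initConfig M (unary n)))

  X : ℕ → ℕ
  X n = suc (n + suc (suc (poly k n + ℓ n * 2)) + ℓ n + N)

  enough : ∀ n → suc (n + suc (suc (poly k n + length (bits (f n)) * 2)) + length (bits (f n)) + N) ≤ X n
  enough n = s≤s (+-monoˡ-≤ N (+-mono-≤ (+-monoʳ-≤ n (s≤s (s≤s (+-monoʳ-≤ (poly k n) (*-monoˡ-≤ 2 (length≤ℓ n)))))) (length≤ℓ n)))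

  phases : ℕ → ℕ
  phases n = 1 + (suc (poly k n) * 11 + (ℓ n * 23 + 8))

  phases≤ : ∀ n → 1 + (suc (poly k n) * 11 + (length (bits (f n)) * 23 + 8)) ≤ phases n
  phases≤ n = s≤s (+-monoʳ-≤ (suc (poly k n) * 11) (+-monoˡ-≤ 8 (*-monoˡ-≤ 23 (length≤ℓ n))))

  sucᵖ : ∀ {g} → PolyBounded g → PolyBounded (λ n → suc (g n))
  sucᵖ = polyBounded-+ (polyBounded-const 1)

  ℓ-poly : PolyBounded ℓ
  ℓ-poly = sucᵖ (polyBounded-* (polyBounded-const (suc b)) (polyBounded-poly k))

  polyTime : PolyBounded (λ n → phases n * X n)
  polyTime = polyBounded-*
    (sucᵖ (polyBounded-+ (polyBounded-* (sucᵖ (polyBounded-poly k)) (polyBounded-const 11))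
                         (polyBounded-+ (polyBounded-* ℓ-poly (polyBounded-const 23)) (polyBounded-const 8))))
    (sucᵖ (polyBounded-+ (polyBounded-+ (polyBounded-+ polyBounded-id
             (sucᵖ (sucᵖ (polyBounded-+ (polyBounded-poly k) (polyBounded-* ℓ-poly (polyBounded-const 2)))))) ℓ-poly)
             (polyBounded-const N)))

-- Tables that defeat bounded advice

funToFin-cong : ∀ {m n} {f g : Fin m → Fin n} → (∀ i → f i ≡ g i) → funToFin f ≡ funToFin g
funToFin-cong {zero}  eq = refl
funToFin-cong {suc m} eq = cong₂ combine (eq zero) (funToFin-cong (λ i → eq (suc i)))

module 2↔Bool = Inverse Fin.2↔Bool

bitAt : ∀ m → Fin (2 ^ m) → Fin m → Bool
bitAt m u i = 2↔Bool.to (finToFun {2} {m} u i)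

fromBits : ∀ {m} → (Fin m → Bool) → Fin (2 ^ m)
fromBits {m} g = funToFin {m} {2} (λ i → 2↔Bool.from (g i))

bitAt-fromBits : ∀ {m} (g : Fin m → Bool) i → bitAt m (fromBits g) i ≡ g i
bitAt-fromBits g i = trans (cong 2↔Bool.to (finToFun-funToFin (λ i → 2↔Bool.from (g i)) i)) (2↔Bool.inverseˡ refl)

fromBits-bitAt : ∀ m (u : Fin (2 ^ m)) → fromBits (bitAt m u) ≡ u
fromBits-bitAt m u = trans (funToFin-cong {m} (λ i → 2↔Bool.inverseʳ refl)) (funToFin-finToFin {m} {2} u)

bitAt-injective : ∀ m {u v : Fin (2 ^ m)} → (∀ i → bitAt m u i ≡ bitAt m v i) → u ≡ v
bitAt-injective m {u} {v} eq = trans (sym (fromBits-bitAt m u))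
  (trans (funToFin-cong {m} (λ i → cong 2↔Bool.from (eq i))) (fromBits-bitAt m v))

-- Pigeonhole: otherwise the positions in xs would inject `Fin B` into a smaller finite set.
avoids-list : ∀ {B} (g : Fin B → List Bool) → Injective _≡_ _≡_ g → ∀ xs → length xs < B → ∃ λ i → g i ∉ xs
avoids-list {B} g inj xs xs<B = ¬∀⟶∃¬ B (λ i → g i ∈ xs) (λ i → g i ∈? xs) λ all∈ →
  <⇒≱ xs<B (injective⇒≤ {f = λ i → Any.index (all∈ i)} λ {i} {i′} eq →
    inj (trans (lookup-index (all∈ i)) (trans (cong (lookup xs) eq) (sym (lookup-index (all∈ i′))))))

concatFin : ∀ {A : Set} K → (Fin K → List A) → List A
concatFin zero    f = []
concatFin (suc K) f = f zero ++ concatFin K (λ i → f (suc i))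

length-concatFin : ∀ {A : Set} {p} K (f : Fin K → List A) → (∀ j → length (f j) ≤ p) → length (concatFin K f) ≤ K * p
length-concatFin zero    f le = z≤n
length-concatFin (suc K) f le = ≤-trans (≤-reflexive (length-++ (f zero)))
  (+-mono-≤ (le zero) (length-concatFin K (λ i → f (suc i)) (λ i → le (suc i))))

∈-concatFin : ∀ {A : Set} K (f : Fin K → List A) j {x} → x ∈ f j → x ∈ concatFin K f
∈-concatFin (suc K) f zero    x∈ = ∈-++⁺ˡ x∈
∈-concatFin (suc K) f (suc j) x∈ = ∈-++⁺ʳ (f zero) (∈-concatFin K (λ i → f (suc i)) j x∈)

concatFin-cong : ∀ {A : Set} K {f g : Fin K → List A} → (∀ j → f j ≡ g j) → concatFin K f ≡ concatFin K g
concatFin-cong zero    eq = refl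
concatFin-cong (suc K) eq = cong₂ _++_ (eq zero) (concatFin-cong K (λ j → eq (suc j)))

xor-cancelˡ : ∀ x {b c} → (x xor b) ≡ (x xor c) → b ≡ c
xor-cancelˡ true  eq = Bool.not-injective eq
xor-cancelˡ false eq = eq

-- K computations with at most p queries each read a table of K * B secret bits and c bits of advice that may
-- depend arbitrarily on the table; the j-th one is to output a value sensitive to every bit of the j-th row.
-- If all of them succeeded on every table, one could flip, for each row independently, a bit that no
-- computation reads, without changing any computation; the flips can be undone from the flipped table and
-- the advice alone, so (table, flips) ↦ (flipped table, advice) would inject 2^(K*B+K) into 2^(K*B+c).
module Adversary
  {K B c p : ℕ} (c<K : c < K) (Kp<B : K * p < B) (i₀ : Fin B)
  (loc : Fin K → Fin B → List Bool) (loc-injective : ∀ j → Injective _≡_ _≡_ (loc j))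
  (orc : (Fin K → Fin B → Bool) → (Fin c → Bool) → Oracle)
  (orc-cong : ∀ {A A′ a a′} s → (∀ x → a x ≡ a′ x) → (∀ j i → s ≡ loc j i → A j i ≡ A′ j i) → orc A a s ≡ orc A′ a′ s)
  {Out : Set} (_≟_ : DecidableEquality Out)
  (res : Fin K → Oracle → Out) (asked : Fin K → Oracle → List (List Bool))
  (length-asked : ∀ j O → length (asked j O) ≤ p)
  (asked-determine : ∀ j {O O′} → (∀ s → s ∈ asked j O → O s ≡ O′ s) → asked j O ≡ asked j O′ × res j O ≡ res j O′)
  (val : Fin K → (Fin K → Fin B → Bool) → Out)
  (val-sensitive : ∀ j i {A A′} → (∀ i′ → i′ ≢ i → A j i′ ≡ A′ j i′) → A j i ≢ A′ j i → val j A ≢ val j A′)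
  (adv : (Fin K → Fin B → Bool) → Fin c → Bool)
  where

  private
    Matrix : Set
    Matrix = Fin K → Fin B → Bool

    decodeTable : Fin (2 ^ (K * B)) → Matrix
    decodeTable u j i = bitAt (K * B) u (combine j i)

    encodeTable : Matrix → Fin (2 ^ (K * B))
    encodeTable A = fromBits (λ x → uncurry A (remQuot B x))

    decode-encodeTable : ∀ A j i → decodeTable (encodeTable A) j i ≡ A j i
    decode-encodeTable A j i = trans (bitAt-fromBits (λ x → uncurry A (remQuot B x)) (combine j i))
      (cong (uncurry A) (remQuot-combine j i))

    decodeTable-injective : ∀ {u v} → (∀ j i → decodeTable u j i ≡ decodeTable v j i) → u ≡ v
    decodeTable-injective {u} {v} eq = bitAt-injective (K * B) λ x →
      subst (λ y → bitAt (K * B) u y ≡ bitAt (K * B) v y) (combine-remQuot {K} B x) (eq (proj₁ (remQuot {K} B x)) (proj₂ (remQuot {K} B x)))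

    allAsked : Oracle → List (List Bool)
    allAsked O = concatFin K (λ j → asked j O)

    -- The choice depends on the query list alone, so it can be repeated from the flipped table. The
    -- value i₀ is a default for the case that no cell is left, which `pick-∉` excludes.
    pick : Fin K → List (List Bool) → Fin B
    pick j xs with any? (λ i → ¬? (loc j i ∈? xs))
    ... | yes (i , _) = i
    ... | no  _       = i₀

    pick-∉ : ∀ j O → loc j (pick j (allAsked O)) ∉ allAsked O
    pick-∉ j O with any? (λ i → ¬? (loc j i ∈? allAsked O))
    ... | yes (_ , ∉) = ∉
    ... | no  none    = contradiction
      (avoids-list (loc j) (loc-injective j) (allAsked O)
        (≤-<-trans (length-concatFin K (λ j → asked j O) (λ j → length-asked j O)) Kp<B)) none

    flipTable : (Fin K → Fin B) → Matrix → (Fin K → Bool) → Matrix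
    flipTable P A b j i with i Fin.≟ P j
    ... | yes _ = A j i xor b j
    ... | no  _ = A j i

    flipTable-at : ∀ P A b j → flipTable P A b j (P j) ≡ A j (P j) xor b j
    flipTable-at P A b j with P j Fin.≟ P j
    ... | yes _  = refl
    ... | no  ¬p = contradiction refl ¬p

    flipTable-off : ∀ P A b j i → i ≢ P j → flipTable P A b j i ≡ A j i
    flipTable-off P A b j i i≢ with i Fin.≟ P j
    ... | yes p = contradiction p i≢
    ... | no  _ = refl

    secret : Matrix → (Fin c → Bool) → Fin K → Fin B
    secret A a j = pick j (allAsked (orc A a))

    -- No computation reads a flipped cell, so all runs survive the flip as long as the old advice
    -- is kept, even if it is not the advice of the flipped table. G and a′ are fixed only
    -- pointwise, so that two preimages can be compared with one common oracle.
    unaffected : ∀ A a b {G a′} → (∀ j i → flipTable (secret A a) A b j i ≡ G j i) → (∀ x → a x ≡ a′ x) →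
      ∀ j → asked j (orc A a) ≡ asked j (orc G a′) × res j (orc A a) ≡ res j (orc G a′)
    unaffected A a b {G} flip≗G a≗ j = asked-determine j λ s s∈ → orc-cong s a≗ λ j′ i s≡ →
      trans (sym (flipTable-off (secret A a) A b j′ i λ i≡ →
        pick-∉ j′ (orc A a) (subst (_∈ allAsked (orc A a)) (trans s≡ (cong (loc j′) i≡)) (∈-concatFin K _ j s∈))))
      (flip≗G j′ i)

    Correct : Matrix → Set
    Correct A = ∀ j → res j (orc A (adv A)) ≡ val j A

    flipped : Matrix → (Fin K → Bool) → Matrix
    flipped A b = flipTable (secret A (adv A)) A b

    module _ (A₁ A₂ : Matrix) (b₁ b₂ : Fin K → Bool) (ok₁ : Correct A₁) (ok₂ : Correct A₂)
      (sameTable : ∀ j i → flipped A₁ b₁ j i ≡ flipped A₂ b₂ j i) (sameAdvice : ∀ x → adv A₁ x ≡ adv A₂ x) where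

      P₁ = secret A₁ (adv A₁)
      P₂ = secret A₂ (adv A₂)
      runs₁ = unaffected A₁ (adv A₁) b₁ {flipped A₁ b₁} (λ _ _ → refl) (λ _ → refl)
      runs₂ = unaffected A₂ (adv A₂) b₂ {flipped A₁ b₁} (λ j i → sym (sameTable j i)) (λ x → sym (sameAdvice x))

      sameSecret : ∀ j → P₁ j ≡ P₂ j
      sameSecret j = cong (pick j) (concatFin-cong K (λ j′ → trans (proj₁ (runs₁ j′)) (sym (proj₁ (runs₂ j′)))))

      sameOff : ∀ j i → i ≢ P₁ j → A₁ j i ≡ A₂ j i
      sameOff j i i≢ = begin
        A₁ j i              ≡⟨ sym (flipTable-off P₁ A₁ b₁ j i i≢) ⟩
        flipped A₁ b₁ j i   ≡⟨ sameTable j i ⟩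
        flipped A₂ b₂ j i   ≡⟨ flipTable-off P₂ A₂ b₂ j i (λ i≡ → i≢ (trans i≡ (sym (sameSecret j)))) ⟩
        A₂ j i              ∎
        where open ≡-Reasoning

      sameAt : ∀ j → A₁ j (P₁ j) xor b₁ j ≡ A₂ j (P₁ j) xor b₂ j
      sameAt j = begin
        A₁ j (P₁ j) xor b₁ j       ≡⟨ sym (flipTable-at P₁ A₁ b₁ j) ⟩
        flipped A₁ b₁ j (P₁ j)     ≡⟨ sameTable j (P₁ j) ⟩
        flipped A₂ b₂ j (P₁ j)     ≡⟨ cong (flipped A₂ b₂ j) (sameSecret j) ⟩
        flipped A₂ b₂ j (P₂ j)     ≡⟨ flipTable-at P₂ A₂ b₂ j ⟩
        A₂ j (P₂ j) xor b₂ j       ≡⟨ cong (λ i → A₂ j i xor b₂ j) (sym (sameSecret j)) ⟩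
        A₂ j (P₁ j) xor b₂ j       ∎
        where open ≡-Reasoning

      sameVal : ∀ j → val j A₁ ≡ val j A₂
      sameVal j = trans (sym (ok₁ j)) (trans (proj₂ (runs₁ j)) (trans (sym (proj₂ (runs₂ j))) (ok₂ j)))

      -- Correctness forces equal values, and off the secret cell the rows already agree; by
      -- sensitivity a difference at that cell would show in the value.
      sameA-at : ∀ j → A₁ j (P₁ j) ≡ A₂ j (P₁ j)
      sameA-at j = decidable-stable (A₁ j (P₁ j) Bool.≟ A₂ j (P₁ j)) λ differ →
        val-sensitive j (P₁ j) (sameOff j) differ (sameVal j)

      unflip-table : ∀ j i → A₁ j i ≡ A₂ j i
      unflip-table j i with i Fin.≟ P₁ j
      ... | yes refl = sameA-at j
      ... | no  i≢   = sameOff j i i≢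

      unflip-bits : ∀ j → b₁ j ≡ b₂ j
      unflip-bits j = xor-cancelˡ (A₁ j (P₁ j)) (trans (sameAt j) (cong (_xor b₂ j) (sym (sameA-at j))))

    Φ : Fin (2 ^ (K * B) * 2 ^ K) → Fin (2 ^ (K * B) * 2 ^ c)
    Φ t = combine (encodeTable (flipped A (bitAt K (proj₂ uv)))) (fromBits (adv A))
      where
      uv = remQuot {2 ^ (K * B)} (2 ^ K) t
      A  = decodeTable (proj₁ uv)

    Φ-injective : (∀ u → Correct (decodeTable u)) → Injective _≡_ _≡_ Φ
    Φ-injective ok {t} {t′} eq = begin
      t                                  ≡⟨ sym (combine-remQuot {2 ^ (K * B)} (2 ^ K) t) ⟩
      combine (proj₁ uv) (proj₂ uv)      ≡⟨ cong₂ combine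
        (decodeTable-injective (unflip-table A A′ b b′ (ok _) (ok _) sameT sameA))
        (bitAt-injective K (unflip-bits A A′ b b′ (ok _) (ok _) sameT sameA)) ⟩
      combine (proj₁ uv′) (proj₂ uv′)    ≡⟨ combine-remQuot {2 ^ (K * B)} (2 ^ K) t′ ⟩
      t′                                 ∎
      where
      open ≡-Reasoning
      uv  = remQuot {2 ^ (K * B)} (2 ^ K) t
      uv′ = remQuot {2 ^ (K * B)} (2 ^ K) t′
      A  = decodeTable (proj₁ uv)
      A′ = decodeTable (proj₁ uv′)
      b b′ : Fin K → Bool
      b  = bitAt K (proj₂ uv)
      b′ = bitAt K (proj₂ uv′)
      parts = combine-injective (encodeTable (flipped A b)) (fromBits (adv A)) (encodeTable (flipped A′ b′)) (fromBits (adv A′)) eq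
      sameT : ∀ j i → flipped A b j i ≡ flipped A′ b′ j i
      sameT j i = trans (sym (decode-encodeTable (flipped A b) j i))
        (trans (cong (λ u → decodeTable u j i) (proj₁ parts)) (decode-encodeTable (flipped A′ b′) j i))
      sameA : ∀ x → adv A x ≡ adv A′ x
      sameA x = trans (sym (bitAt-fromBits (adv A) x)) (trans (cong (λ u → bitAt c u x) (proj₂ parts)) (bitAt-fromBits (adv A′) x))

    not-all-correct : ¬ (∀ u → Correct (decodeTable u))
    not-all-correct ok = <⇒≱ (*-monoʳ-< (2 ^ (K * B)) {{m^n≢0 2 (K * B)}} (^-monoʳ-< 2 (s≤s (s≤s z≤n)) c<K))
      (injective⇒≤ (Φ-injective ok))

  -- There are finitely many tables and correctness is decidable, so the failing table is found by
  -- search.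
  some-table-fails : ∃ λ A → ∃ λ j → res j (orc A (adv A)) ≢ val j A
  some-table-fails = A , ¬∀⟶∃¬ K (λ j → res j (orc A (adv A)) ≡ val j A) (λ j → res j (orc A (adv A)) ≟ val j A) (proj₂ wrong)
    where
    wrong = ¬∀⟶∃¬ (2 ^ (K * B)) (λ u → Correct (decodeTable u))
      (λ u → Fin.all? λ j → res j (orc (decodeTable u) (adv (decodeTable u))) ≟ val j (decodeTable u)) not-all-correct
    A : Matrix
    A = decodeTable (proj₁ wrong)

-- The hard counting function

-- The accumulator q is the interleaving so far, in reverse order because the machine builds its
-- query by prepending.
rowCount : Oracle → List Bool → List Bool → ℕ
rowCount F q []      = if F q then 1 else 0
rowCount F q (b ∷ x) = rowCount F (false ∷ b ∷ q) x + rowCount F (true ∷ b ∷ q) x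

guesser : OTM
guesser = record { Q = 5 ; start = reading ; kind = κ ; δ = d ; answer = a }
  where
  reading guessing asking′ yes′ no′ : Fin 5
  reading  = zero
  guessing = suc zero
  asking′  = suc (suc zero)
  yes′     = suc (suc (suc zero))
  no′      = suc (suc (suc (suc zero)))
  κ : Fin 5 → Kind
  κ zero                         = normal
  κ (suc zero)                   = normal
  κ (suc (suc zero))             = query
  κ (suc (suc (suc zero)))       = accept
  κ (suc (suc (suc (suc zero)))) = reject
  d : Fin 5 → Sym → Sym → List (Fin 5 × Sym × Move × Sym × Move)
  d zero       (bit b) _ = (guessing , bit b , S , bit b , L) ∷ []
  d zero       blank   _ = (asking′ , blank , S , bit false , L) ∷ []
  d (suc zero) x       _ = (reading , x , R , bit false , L) ∷ (reading , x , R , bit true , L) ∷ []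
  d _          _       _ = []
  a : Fin 5 → Bool → Fin 5
  a _ b = if b then yes′ else no′

module _ (O : Oracle) where

  reads : List Sym → List Bool → List Bool → Config guesser
  reads l x q = config zero (popR l (toSyms x)) (queryTape q)

  -- Two steps per letter, one to copy it and one to guess; then one step for the leading 0 and one
  -- for the query. The rest s is slack.
  guesser-count : ∀ l x q s → accCount O guesser (length x * 2 + suc (suc s)) (reads l x q) ≡ rowCount (λ w → O (false ∷ w)) q x
  guesser-count l [] q s rewrite symsBits-toSyms q with O (false ∷ q)
  ... | true  = refl
  ... | false = refl
  guesser-count l (b ∷ x) q s rewrite writeMove-R (bit b) l (bit b) (toSyms x) =
    trans (+-identityʳ _) (cong₂ _+_ (guesser-count (bit b ∷ l) x (false ∷ b ∷ q) s)
                                     (trans (+-identityʳ _) (guesser-count (bit b ∷ l) x (true ∷ b ∷ q) s)))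

  guesser-halts : ∀ l x q s → HaltsWithin O guesser (length x * 2 + suc (suc s)) (reads l x q)
  guesser-halts l [] q s rewrite symsBits-toSyms q with O (false ∷ q)
  ... | true  = (tt , tt) , tt
  ... | false = (tt , tt) , tt
  guesser-halts l (b ∷ x) q s rewrite writeMove-R (bit b) l (bit b) (toSyms x) =
    (guesser-halts (bit b ∷ l) x (false ∷ b ∷ q) s , guesser-halts (bit b ∷ l) x (true ∷ b ∷ q) s , tt) , tt

rowCount-SharpP : ∀ F → SharpP (closure F) (rowCount F [])
rowCount-SharpP F = guesser , proj₁ linear , works
  where
  linear : PolyBounded (λ n → n * 2 + 2)
  linear = polyBounded-+ (polyBounded-* polyBounded-id (polyBounded-const 2)) (polyBounded-const 2)
  works : ∀ x → HaltsWithin (closure F) guesser (poly (proj₁ linear) (length x)) (initConfig guesser x)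
              × accCount (closure F) guesser (poly (proj₁ linear) (length x)) (initConfig guesser x) ≡ rowCount F [] x
  works x with m≤n⇒∃[o]m+o≡n (proj₂ linear (length x))
  ... | s , eq rewrite sym eq | +-assoc (length x * 2) 2 s | inputTape-popR x =
    guesser-halts (closure F) [] x [] s , guesser-count (closure F) [] x [] s

-- Follows the branch of `rowCount` on x along the guesses y. The last clause also gives a junk
-- value for words of unequal length; the lemmas below assume equal lengths.
slot : List Bool → List Bool → List Bool → List Bool
slot q (b ∷ x) (g ∷ y) = slot (g ∷ b ∷ q) x y
slot q _       _       = q

length-slot : ∀ q x y → length x ≡ length y → length (slot q x y) ≡ length x * 2 + length q
length-slot q []      []      eq = refl
length-slot q (b ∷ x) (g ∷ y) eq = trans (length-slot (g ∷ b ∷ q) x y (suc-injective eq))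
  (trans (+-suc (length x * 2) (suc (length q))) (cong suc (+-suc (length x * 2) (length q))))

slot-injective : ∀ {q q′} x y x′ y′ → length x ≡ length y → length x ≡ length x′ → length x ≡ length y′ →
  slot q x y ≡ slot q′ x′ y′ → q ≡ q′ × x ≡ x′ × y ≡ y′
slot-injective []      []      []        []        _ _ _ eq = eq , refl , refl
slot-injective (b ∷ x) (g ∷ y) (b′ ∷ x′) (g′ ∷ y′) l l′ l″ eq
  with slot-injective x y x′ y′ (suc-injective l) (suc-injective l′) (suc-injective l″) eq
... | refl , refl , refl = refl , refl , refl

rowCount-cong : ∀ {F G} q x → (∀ y → length x ≡ length y → F (slot q x y) ≡ G (slot q x y)) → rowCount F q x ≡ rowCount G q x
rowCount-cong q []      ag = cong (if_then 1 else 0) (ag [] refl)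
rowCount-cong q (b ∷ x) ag = cong₂ _+_ (rowCount-cong (false ∷ b ∷ q) x (λ y eq → ag (false ∷ y) (cong suc eq)))
                                       (rowCount-cong (true ∷ b ∷ q) x (λ y eq → ag (true ∷ y) (cong suc eq)))

-- The changed cell lies in one half of the tree of guesses; the other half contributes equally and
-- cancels, down to a single leaf.
rowCount-sensitive : ∀ {F G} q x y → length x ≡ length y →
  (∀ y′ → length x ≡ length y′ → y′ ≢ y → F (slot q x y′) ≡ G (slot q x y′)) → F (slot q x y) ≢ G (slot q x y) →
  rowCount F q x ≢ rowCount G q x
rowCount-sensitive {F} {G} q [] [] _ ag differ eq with F q | G q | differ | eq
... | true  | true  | differ′ | _  = differ′ refl
... | false | false | differ′ | _  = differ′ refl
... | true  | false | _       | ()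
... | false | true  | _       | ()
rowCount-sensitive {F} {G} q (b ∷ x) (false ∷ y) l ag differ eq =
  rowCount-sensitive (false ∷ b ∷ q) x y (suc-injective l)
    (λ y′ l′ y′≢ → ag (false ∷ y′) (cong suc l′) (y′≢ ∘ ∷-injectiveʳ)) differ
    (+-cancelʳ-≡ _ _ _ (trans eq (cong (rowCount G (false ∷ b ∷ q) x +_)
      (sym (rowCount-cong (true ∷ b ∷ q) x (λ y′ l′ → ag (true ∷ y′) (cong suc l′) λ ()))))))
rowCount-sensitive {F} {G} q (b ∷ x) (true ∷ y) l ag differ eq =
  rowCount-sensitive (true ∷ b ∷ q) x y (suc-injective l)
    (λ y′ l′ y′≢ → ag (true ∷ y′) (cong suc l′) (y′≢ ∘ ∷-injectiveʳ)) differ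
    (+-cancelˡ-≡ _ _ _ (trans eq (cong (_+ rowCount G (true ∷ b ∷ q) x)
      (sym (rowCount-cong (false ∷ b ∷ q) x (λ y′ l′ → ag (false ∷ y′) (cong suc l′) λ ()))))))

string : ∀ n → Fin (2 ^ n) → List Bool
string n u = tabulate (bitAt n u)

length-string : ∀ n u → length (string n u) ≡ n
length-string n u = length-tabulate (bitAt n u)

tabulate-injective : ∀ {A : Set} {n} {f g : Fin n → A} → tabulate f ≡ tabulate g → ∀ i → f i ≡ g i
tabulate-injective {n = suc n} eq zero    = ∷-injectiveˡ eq
tabulate-injective {n = suc n} eq (suc i) = tabulate-injective (∷-injectiveʳ eq) i

string-injective : ∀ n → Injective _≡_ _≡_ (string n)
string-injective n eq = bitAt-injective n (tabulate-injective eq)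

-- Coded answers as advice

Finite-⁴ : ∀ s → Finite (Fin s × Fin s × Fin s × Fin s)
Finite-⁴ s = Finite-× (Finite-Fin s) (Finite-× (Finite-Fin s) (Finite-× (Finite-Fin s) (Finite-Fin s)))

toℕ⁴ : ∀ {s} → Fin s × Fin s × Fin s × Fin s → Runs
toℕ⁴ (e , i , n , m) = toℕ e , toℕ i , toℕ n , toℕ m

abstract
  adviceBits : ℕ → ℕ
  adviceBits t = Finite.size (Finite-⁴ (suc t))

  runsIndex : ∀ t → Runs → Fin (adviceBits t)
  runsIndex t (e , i , n , m) = Finite.to (Finite-⁴ (suc t)) (clamp t e , clamp t i , clamp t n , clamp t m)

  indexRuns : ∀ t → Fin (adviceBits t) → Runs
  indexRuns t x = toℕ⁴ (Finite.from (Finite-⁴ (suc t)) x)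

  indexRuns-runsIndex : ∀ t {e i n m} → e ≤ t → i ≤ t → n ≤ t → m ≤ t →
    indexRuns t (runsIndex t (e , i , n , m)) ≡ (e , i , n , m)
  indexRuns-runsIndex t {e} {i} {n} {m} e≤ i≤ n≤ m≤ =
    trans (cong toℕ⁴ (Finite.from-to (Finite-⁴ (suc t)) (clamp t e , clamp t i , clamp t n , clamp t m)))
      (cong₂ _,_ (toℕ-clamp e≤) (cong₂ _,_ (toℕ-clamp i≤) (cong₂ _,_ (toℕ-clamp n≤) (toℕ-clamp m≤))))

  -- The first factor is the number K of rows, one more than the advice bits. Having this product
  -- below 2^n leaves an unread cell in every row, and the `suc` in the second factor also gives K ≤
  -- 2^n at once.
  advicePoly : ∀ k → PolyBounded (λ n → suc (adviceBits (poly k n)) * suc (poly k n))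
  advicePoly k = polyBounded-* (sucᵖ (polyBounded-* t (polyBounded-* t (polyBounded-* t t)))) t
    where
    sucᵖ : ∀ {g} → PolyBounded g → PolyBounded (λ n → suc (g n))
    sucᵖ = polyBounded-+ (polyBounded-const 1)
    t : PolyBounded (λ n → suc (poly k n))
    t = sucᵖ (polyBounded-poly k)

-- Construction of the free set in stages

Stage : Set
Stage = Σ Oracle λ F → Σ ℕ λ h → ∀ w → h ≤ length w → F w ≡ false

Extends : Stage → Stage → Set
Extends (F , h , _) (F′ , h′ , _) = h < h′ × AgreeBelow h F F′

-- The two bounds make the defeat permanent: the run asks only strings of length at most h, and the
-- count looks at F only at length 2|x| < h, so no change from h on can undo it.
Defeats : ℕ → OTM → Stage → Set
Defeats k T (F , h , _) = Σ (List Bool) λ x → poly k (length x) ≤ h × length x * 2 < h ×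
  Maybe.map output (run (closure F) T (poly k (length x)) (initConfig T x)) ≢ just (bits (rowCount F [] x))

module Diagonalise (k : ℕ) (T : OTM) (F₀ : Oracle) (h : ℕ) (F₀-empty : ∀ w → h ≤ length w → F₀ w ≡ false)
  (n : ℕ) (h≤n : h ≤ n) (K B t : ℕ) (t≡ : poly k n ≡ t) (B≡ : B ≡ 2 ^ n)
  (c<K : adviceBits t < K) (K*t<B : K * t < B) (K≤B : K ≤ B) (i₀ : Fin B) where

  c : ℕ
  c = adviceBits t

  col : Fin B → List Bool
  col i = string n (subst Fin B≡ i)

  row : Fin K → List Bool
  row j = col (inject≤ j K≤B)

  length-col : ∀ i → length (col i) ≡ n
  length-col i = length-string n (subst Fin B≡ i)

  col-injective : Injective _≡_ _≡_ col
  col-injective {i} {i′} eq = subst-injective B≡ (string-injective n eq)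

  cell : Fin K → Fin B → List Bool
  cell j i = slot [] (row j) (col i)

  length-row : ∀ j → length (row j) ≡ n
  length-row j = length-col (inject≤ j K≤B)

  row≡col : ∀ j i → length (row j) ≡ length (col i)
  row≡col j i = trans (length-row j) (sym (length-col i))

  length-cell : ∀ j i → length (cell j i) ≡ n * 2
  length-cell j i = trans (length-slot [] (row j) (col i) (row≡col j i)) (trans (+-identityʳ _) (cong (_* 2) (length-row j)))

  cell-injective : ∀ {j i j′ i′} → cell j i ≡ cell j′ i′ → j ≡ j′ × i ≡ i′
  cell-injective {j} {i} {j′} {i′} eq
    with slot-injective (row j) (col i) (row j′) (col i′) (row≡col j i) (trans (length-row j) (sym (length-row j′))) (row≡col j i′) eq
  ... | _ , rows , cols = inject≤-injective K≤B K≤B j j′ (col-injective rows) , col-injective cols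

  Matrix : Set
  Matrix = Fin K → Fin B → Bool

  Marked : Matrix → List Bool → Set
  Marked A w = ∃ λ j → ∃ λ i → w ≡ cell j i × A j i ≡ true

  abstract
    marked? : ∀ A w → Dec (Marked A w)
    marked? A w = any? λ j → any? λ i → ≡-dec Bool._≟_ w (cell j i) ×-dec (A j i Bool.≟ true)

  table : Matrix → Oracle
  table A w = does (marked? A w) ∨ F₀ w

  table-unmarked : ∀ A w → ¬ Marked A w → table A w ≡ F₀ w
  table-unmarked A w ¬m with marked? A w
  ... | yes m = contradiction m ¬m
  ... | no  _ = refl

  table-outside : ∀ A w → length w ≢ n * 2 → table A w ≡ F₀ w
  table-outside A w ≢ = table-unmarked A w λ (j , i , w≡ , _) → ≢ (trans (cong length w≡) (length-cell j i))

  table-cell : ∀ A j i → table A (cell j i) ≡ A j i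
  table-cell A j i with marked? A (cell j i) | A j i in Aji
  ... | yes _                  | true  = refl
  ... | yes (j′ , i′ , eq , m) | false with cell-injective {j} {i} {j′} {i′} eq
  ...   | refl , refl = trans (sym m) Aji
  table-cell A j i | no ¬m | true  = contradiction (j , i , refl , Aji) ¬m
  -- Cells have length 2n, which is at least h, so the earlier stage left them empty.
  table-cell A j i | no _  | false = F₀-empty (cell j i)
    (≤-trans h≤n (≤-trans (m≤m*n n 2) (≤-reflexive (sym (length-cell j i)))))

  table-cong : ∀ {A A′} w → (∀ j i → w ≡ cell j i → A j i ≡ A′ j i) → table A w ≡ table A′ w
  table-cong {A} {A′} w same with marked? A w | marked? A′ w
  ... | yes _                 | yes _ = refl
  ... | no _                  | no _  = refl
  ... | yes (j , i , eq , m)  | no ¬m = contradiction (j , i , eq , trans (sym (same j i eq)) m) ¬m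
  ... | no ¬m | yes (j , i , eq , m)  = contradiction (j , i , eq , trans (same j i eq) m) ¬m

  withAdvice : Matrix → (Fin c → Bool) → Oracle
  withAdvice A a []          = false
  withAdvice A a (false ∷ w) = table A w
  withAdvice A a (true ∷ w)  = a (runsIndex t (runs w))

  advice : Matrix → Fin c → Bool
  advice A x = runsAnswer (closure (table A)) (indexRuns t x)

  withAdvice-cong : ∀ {A A′ a a′} s → (∀ x → a x ≡ a′ x) → (∀ j i → s ≡ false ∷ cell j i → A j i ≡ A′ j i) →
    withAdvice A a s ≡ withAdvice A′ a′ s
  withAdvice-cong []          a≗ same = refl
  withAdvice-cong (false ∷ w) a≗ same = table-cong w (λ j i eq → same j i (cong (false ∷_) eq))
  withAdvice-cong (true ∷ w)  a≗ same = a≗ _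

  -- All influence of the table on the coded strings of length at most t passes through
  -- `adviceBits t` bits. On longer strings clamping may give other answers, but a run of time t
  -- asks none of them.
  closure-withAdvice : ∀ A → AgreeUpTo t (closure (table A)) (withAdvice A (advice A))
  closure-withAdvice A []          s≤ = refl
  closure-withAdvice A (false ∷ w) s≤ = refl
  closure-withAdvice A (true ∷ w)  s≤ with runs-bounded w
  ... | e≤ , i≤ , n≤ , m≤ = trans (closure-unfold (table A) (true ∷ w)) (cong (runsAnswer (closure (table A)))
    (sym (indexRuns-runsIndex t (≤-trans e≤ w≤) (≤-trans i≤ w≤) (≤-trans n≤ w≤) (≤-trans m≤ w≤))))
    where
    w≤ : length w ≤ t
    w≤ = <⇒≤ s≤

  result : Fin K → Oracle → Maybe (List Bool)
  result j O = Maybe.map output (run O T t (initConfig T (row j)))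

  target : Fin K → Matrix → Maybe (List Bool)
  target j A = just (bits (rowCount (table A) [] (row j)))

  target-sensitive : ∀ j i {A A′} → (∀ i′ → i′ ≢ i → A j i′ ≡ A′ j i′) → A j i ≢ A′ j i → target j A ≢ target j A′
  target-sensitive j i {A} {A′} same differ eq =
    rowCount-sensitive {table A} {table A′} [] (row j) (col i) (row≡col j i) agree
      (λ eq′ → differ (trans (sym (table-cell A j i)) (trans eq′ (table-cell A′ j i))))
      (bits-injective (Maybe.just-injective eq))
    where
    agree : ∀ y → length (row j) ≡ length y → y ≢ col i → table A (slot [] (row j) y) ≡ table A′ (slot [] (row j) y)
    agree y l y≢ = table-cong _ sameAt
      where
      sameAt : ∀ j′ i′ → slot [] (row j) y ≡ cell j′ i′ → A j′ i′ ≡ A′ j′ i′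
      sameAt j′ i′ eq″ with slot-injective (row j) y (row j′) (col i′) l (trans (length-row j) (sym (length-row j′))) (row≡col j i′) eq″
      ... | _ , rows , refl with inject≤-injective K≤B K≤B j j′ (col-injective rows)
      ...   | refl = same i′ (λ { refl → y≢ refl })

  determined : ∀ j {O O′} → (∀ s → s ∈ queries T O t (initConfig T (row j)) → O s ≡ O′ s) →
    queries T O t (initConfig T (row j)) ≡ queries T O′ t (initConfig T (row j)) × result j O ≡ result j O′
  determined j ag with queries-determine-run T t (initConfig T (row j)) ag
  ... | eq , eq′ = eq , cong (Maybe.map output) eq′

  defeating : ∃ λ A → ∃ λ j → result j (withAdvice A (advice A)) ≢ target j A
  defeating = Adversary.some-table-fails {K} {B} {c} {t} c<K K*t<B i₀
    (λ j i → false ∷ cell j i) (λ j eq → proj₂ (cell-injective (∷-injectiveʳ eq)))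
    withAdvice withAdvice-cong (Maybe.≡-dec (≡-dec Bool._≟_))
    result (λ j O → queries T O t (initConfig T (row j))) (λ j O → length-queries T O t (initConfig T (row j)))
    determined target target-sensitive advice

  stageOf : ∀ A j → result j (withAdvice A (advice A)) ≢ target j A →
    Σ Stage λ st → Extends (F₀ , h , F₀-empty) st × Defeats k T st
  stageOf A j wrong = (table A , h′ , empty) , (h<h′ , agree) , row j , time≤ , size< , wrong′
    where
    -- Above the length 2n of the new cells and above t, the longest possible query of the defeated
    -- run.
    h′ : ℕ
    h′ = suc (n * 2 + t)
    n*2<h′ : n * 2 < h′
    n*2<h′ = s≤s (m≤m+n (n * 2) t)
    h<h′ : h < h′
    h<h′ = ≤-<-trans (≤-trans h≤n (m≤m*n n 2)) n*2<h′
    empty : ∀ w → h′ ≤ length w → table A w ≡ false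
    empty w h′≤ = trans (table-outside A w (λ eq → <⇒≱ n*2<h′ (≤-trans h′≤ (≤-reflexive eq)))) (F₀-empty w (≤-trans (<⇒≤ h<h′) h′≤))
    agree : AgreeBelow h F₀ (table A)
    agree w w<h = sym (table-outside A w (λ eq → <⇒≱ w<h (≤-trans (≤-trans h≤n (m≤m*n n 2)) (≤-reflexive (sym eq)))))
    time≤ : poly k (length (row j)) ≤ h′
    time≤ = ≤-trans (≤-reflexive (trans (cong (poly k) (length-row j)) t≡)) (m≤n⇒m≤1+n (m≤n+m t (n * 2)))
    size< : length (row j) * 2 < h′
    size< = subst (λ ℓ → ℓ * 2 < h′) (sym (length-row j)) n*2<h′
    wrong′ : Maybe.map output (run (closure (table A)) T (poly k (length (row j))) (initConfig T (row j))) ≢ target j A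
    wrong′ eq = wrong (trans (cong (Maybe.map output)
        (sym (run-local T t (initConfig T (row j)) (closure-withAdvice A))))
      (trans (cong (λ u → Maybe.map output (run (closure (table A)) T u (initConfig T (row j)))) (sym (trans (cong (poly k) (length-row j)) t≡))) eq))

  stage : Σ Stage λ st → Extends (F₀ , h , F₀-empty) st × Defeats k T st
  stage = stageOf (proj₁ defeating) (proj₁ (proj₂ defeating)) (proj₂ (proj₂ defeating))

advanceAt : ∀ k T st n → proj₁ (proj₂ st) ≤ n → suc (adviceBits (poly k n)) * suc (poly k n) < 2 ^ n →
  Σ Stage λ st′ → Extends st st′ × Defeats k T st′
advanceAt k T (F₀ , h , empty) n h≤n large =
  Diagonalise.stage k T F₀ h empty n h≤n K (2 ^ n) t refl refl ≤-refl
    (≤-<-trans (*-monoʳ-≤ K (n≤1+n t)) large) K≤B (inject≤ zero K≤B)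
  where
  t K : ℕ
  t = poly k n
  K = suc (adviceBits t)
  K≤B : K ≤ 2 ^ n
  K≤B = ≤-trans (m≤m*n K (suc t)) (<⇒≤ large)

abstract
  advance : ∀ k T st → Σ Stage λ st′ → Extends st st′ × Defeats k T st′
  advance k T st = advanceAt k T st (proj₁ n) (proj₁ (proj₂ n)) (proj₂ (proj₂ n))
    where
    n : Σ ℕ λ n → proj₁ (proj₂ st) ≤ n × suc (adviceBits (poly k n)) * suc (poly k n) < 2 ^ n
    n = exp-dominates (advicePoly k) (proj₁ (proj₂ st))

-- The limit of the stages

stageAt : ℕ → Stage
stageAt zero    = (λ _ → false) , 0 , λ _ _ → refl
stageAt (suc e) = proj₁ (advance (proj₁ (proj₂ (decode Job-enum e))) (proj₂ (proj₂ (decode Job-enum e))) (stageAt e))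

height : ℕ → ℕ
height e = proj₁ (proj₂ (stageAt e))

free : ℕ → Oracle
free e = proj₁ (stageAt e)

stageAt-extends : ∀ e → Extends (stageAt e) (stageAt (suc e))
stageAt-extends e = proj₁ (proj₂ (advance _ _ (stageAt e)))

height-mono : ∀ e d → height e ≤ height (d + e)
height-mono e zero    = ≤-refl
height-mono e (suc d) = ≤-trans (height-mono e d) (<⇒≤ (proj₁ (stageAt-extends (d + e))))

height-≥ : ∀ e → e ≤ height e
height-≥ zero    = z≤n
height-≥ (suc e) = ≤-<-trans (height-≥ e) (proj₁ (stageAt-extends e))

free-stable : ∀ e d → AgreeBelow (height e) (free e) (free (d + e))
free-stable e zero    w w< = refl
free-stable e (suc d) w w< = trans (free-stable e d w w<)
  (proj₂ (stageAt-extends (d + e)) w (≤-trans w< (height-mono e d)))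

-- Heights grow by at least one per stage, so w is settled from stage |w|+1 on.
freeLimit : Oracle
freeLimit w = free (suc (length w)) w

freeLimit-agree : ∀ e → AgreeBelow (height e) freeLimit (free e)
freeLimit-agree e w w< with ≤-total e (suc (length w))
... | inj₁ e≤ with m≤n⇒∃[o]m+o≡n e≤
...   | d , eq = sym (trans (free-stable e d w w<) (cong (λ m → free m w) (trans (+-comm d e) eq)))
freeLimit-agree e w w< | inj₂ ≤e with m≤n⇒∃[o]m+o≡n ≤e
...   | d , eq = trans (free-stable (suc (length w)) d w (height-≥ (suc (length w))))
                       (cong (λ m → free m w) (trans (+-comm d (suc (length w))) eq))

-- Stage e+1 defeats the clock and machine coded by e; the mode in the code is arbitrary here. Both
-- the run and the count are then carried from that stage to the limit.
rowCount-hard : ¬ FP (closure freeLimit) (bits ∘ rowCount freeLimit [])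
rowCount-hard (T , _ , k , computes) =
  refute (decode Job-enum e) (decode-encode Job-enum (padded , k , T)) (proj₂ (proj₂ (advance _ _ (stageAt e))))
  where
  e : ℕ
  e = encode Job-enum (padded , k , T)
  -- Abstracting from the decoded job turns its equations into patterns that `refl` can match.
  refute : ∀ (job : Job) → proj₁ job ≡ padded × proj₁ (proj₂ job) ≡ k × proj₂ (proj₂ job) ≈ᴹ T →
    Defeats (proj₁ (proj₂ job)) (proj₂ (proj₂ job)) (stageAt (suc e)) → ⊥
  refute (_ , _ , T′) (refl , refl , T′≈T) (x , time≤ , size< , wrong) = wrong (begin
    Maybe.map output (run (closure F) T′ (poly k (length x)) (initConfig T′ x))
      ≡⟨ run-≈ (closure F) T′≈T (poly k (length x)) x ⟩
    Maybe.map output (run (closure F) T (poly k (length x)) (initConfig T x))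
      ≡⟨ cong (Maybe.map output) (sym (run-local T (poly k (length x)) (initConfig T x) (AgreeUpTo-≤ time≤ (closure-agree agree)))) ⟩
    Maybe.map output (run (closure freeLimit) T (poly k (length x)) (initConfig T x))
      ≡⟨ computes x ⟩
    just (bits (rowCount freeLimit [] x))
      ≡⟨ cong (just ∘ bits) (rowCount-cong [] x λ y eq →
           agree (slot [] x y) (≤-<-trans (≤-reflexive (trans (length-slot [] x y eq) (+-identityʳ _))) size<)) ⟩
    just (bits (rowCount F [] x)) ∎)
    where
    open ≡-Reasoning
    F = free (suc e)
    agree : AgreeBelow (height (suc e)) freeLimit F
    agree = freeLimit-agree (suc e)

theorem5p1 : Σ Oracle λ D →
    ((f : ℕ → ℕ) → SharpP₁ D f → FPUnary D f)
    × Σ (List Bool → ℕ) (λ f → SharpP D f × ¬ FP D (bits ∘ f))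
theorem5p1 = closure freeLimit , SharpP₁⊆FPUnary freeLimit , rowCount freeLimit [] , rowCount-SharpP freeLimit , rowCount-hard
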